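{- Let $k\ge 1$ be a fixed constant and let $\mathcal P:\{0,1\}^{\binom nk}\to\{0,1\}$ be a non-constant $k$-uniform hypergraph property on vertex set $[n]$. Let $M(\mathcal P)=\max\{\mathsf{N}(\mathcal P),\mathsf{N}(\overline{\mathcal P})\}$. Then \[ M(\mathcal P)\ge \Omega(n^{1/6}). \]
   Context: A $k$-uniform hypergraph on $[n]$ is identified with its indicator vector in $\{0,1\}^{\binom nk}$ indexed by the $k$-subsets of $[n]$ (the hyperedges present). A $k$-uniform hypergraph property is a function $\mathcal P$ on these such that $\mathcal P(H_1)=\mathcal P(H_2)$ whenever $H_1,H_2$ are related by a permutation of $[n]$. $\mathsf{N}(f)$ is the minimum degree of a real polynomial $p$ with $|p(x)|\le 1/3$ whenever $f(x)=0$ and $|p(x)|\ge 1$ whenever $f(x)=1$; $\overline{\mathcal P}=1-\mathcal P$. The $\Omega(\cdot)$ hides a positive constant that may depend on $k$.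
   Formalization: The polynomials in the definition of N(f) are taken with rational instead of real coefficients, so the degree bound is stated for rational approximating polynomials only. -}

module Defs where

open import Data.Bool using (Bool; true; false; not; if_then_else_)
open import Data.Nat as ℕ using (ℕ; _⊔_)
open import Data.Integer using (+_)
open import Data.Rational using (ℚ; _+_; _*_; _≤_; ∣_∣; _/_; 0ℚ; 1ℚ)
open import Data.Fin using (Fin)
open import Data.Fin.Subset using (Subset) renaming (∣_∣ to size)
open import Data.Fin.Permutation using (Permutation′; _⟨$⟩ˡ_)
open import Data.Vec using (tabulate; lookup)
open import Data.List using (List; []; _∷_; length)
open import Data.Product using (Σ; _×_; _,_; proj₁; ∃)
open import Relation.Binary.PropositionalEquality using (_≡_)

KSet : ℕ → ℕ → Set
KSet n k = Σ (Subset n) (λ s → size s ≡ k)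

Hypergraph : ℕ → ℕ → Set
Hypergraph n k = KSet n k → Bool

image : {n : ℕ} → Permutation′ n → Subset n → Subset n
image σ s = tabulate (λ j → lookup s (σ ⟨$⟩ˡ j))

Relabel : {n k : ℕ} → Permutation′ n → Hypergraph n k → Hypergraph n k → Set
Relabel σ H₁ H₂ = ∀ e e′ → proj₁ e′ ≡ image σ (proj₁ e) → H₁ e ≡ H₂ e′

IsHypergraphProperty : {n k : ℕ} → (Hypergraph n k → Bool) → Set
IsHypergraphProperty {n} P =
  ∀ H₁ H₂ (σ : Permutation′ n) → Relabel σ H₁ H₂ → P H₁ ≡ P H₂

NonConstant : {A : Set} → (A → Bool) → Set
NonConstant {A} f = Σ A (λ a → Σ A (λ b → (f a ≡ true) × (f b ≡ false)))

complement : {A : Set} → (A → Bool) → (A → Bool)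
complement P x = not (P x)

-- A polynomial in variables indexed by V: a finite list of terms
-- (coefficient, monomial), the monomial being a list of variables
-- (repetitions allowed, i.e. arbitrary powers).
Poly : Set → Set
Poly V = List (ℚ × List V)

monoDeg : {V : Set} → List V → ℕ
monoDeg = length

degree : {V : Set} → Poly V → ℕ
degree [] = 0
degree ((_ , m) ∷ p) = monoDeg m ⊔ degree p

bit : Bool → ℚ
bit b = if b then 1ℚ else 0ℚ

evalMono : {V : Set} → (V → Bool) → List V → ℚ
evalMono x [] = 1ℚ
evalMono x (v ∷ m) = bit (x v) * evalMono x m

eval : {V : Set} → Poly V → (V → Bool) → ℚ
eval [] x = 0ℚ
eval ((c , m) ∷ p) x = c * evalMono x m + eval p x

-- p witnesses the one-sided-gap approximation from the definition of N(f):
-- |p(x)| ≤ 1/3 when f(x)=0 and |p(x)| ≥ 1 when f(x)=1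
Approximates : {V : Set} → Poly V → ((V → Bool) → Bool) → Set
Approximates p f =
  ∀ x → (f x ≡ false → ∣ eval p x ∣ ≤ (+ 1 / 3))
      × (f x ≡ true → 1ℚ ≤ ∣ eval p x ∣)

module Submission where

-- Let d bound the degrees of p and q, write H[z] for the subhypergraph of H induced by the vertex set z, and let b be
-- the value of P on the empty hypergraph. A monomial of degree d in the edges becomes one of degree at most k d in the
-- vertices when evaluated at H[z]. Take H with P H ≠ b and S of minimal size with P (H[S]) ≠ b. Symmetrising the squares
-- of p and q over the subsets of S gives univariate polynomials that detect a threshold at |S|, so |S| = O(d³) by a
-- Markov-type inequality. Now let v ∈ S, core = S - v, and let Ĥ arise by making every vertex outside core a twin of v.
-- For y outside core, P (Ĥ[core ∪ y]) depends on |y| only and differs at |y| = 0 and |y| = 1. Its values are constant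
-- only on intervals of length O(d³), again by the Markov-type inequality, and the difference of the symmetrised squares
-- has degree O(d) and changes sign with it, so it alternates O(d) times. Hence n = O(d⁴) for constant k.

-- An approximating polynomial may be arbitrarily huge where it is large, so inequalities for
-- polynomials bounded on a whole interval do not apply. What survives is one-sided: a value of at
-- least 1 cannot sit next to a long run of values of at most 1/3. The cubic length of that run is
-- the product of a quadratic spread of the nodes, which keeps the loss of the extrapolation linear
-- in the degree, and a linear factor that makes up for this loss. The one-sided statement shows
-- only that after a change of value another one must follow soon. This is why both polynomials are
-- needed: after each change the other one is small along the next run. It is also why a first
-- change must be supplied at weight 0. By minimality `H[core]` has value `b`, while `core` with one
-- twin gives `H[S]` up to relabelling. The bound on `S` is needed because only the vertices outside
-- `core` become twins.

open import Algebra.Properties.CommutativeSemigroup using (interchange)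
open import Data.Bool using (Bool; true; false; not; if_then_else_; _∧_)
import Data.Bool.Properties as Boolₚ
open import Data.Empty using (⊥; ⊥-elim)
open import Data.Fin using (Fin; zero; suc)
open import Data.Fin.Permutation as Perm using (Permutation′; _⟨$⟩ˡ_; _⟨$⟩ʳ_; _∘ₚ_; lift₀)
import Data.Fin.Properties as Finₚ
open import Data.Fin.Subset using (Subset; _∪_) renaming (∣_∣ to size; ⊥ to ∅; ⊤ to full)
open import Data.Fin.Subset.Properties using (anySubset?; ∣⊥∣≡0)
import Data.Integer.Base as ℤ
import Data.Integer.Properties as ℤₚ
open import Data.List using (List; []; _∷_; length)
open import Data.Maybe using (Maybe; just; nothing)
open import Data.Nat.Base as ℕ using (ℕ; zero; suc; z≤n; s≤s; _≥_; _⊔_; _^_)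
open import Data.Nat.Coprimality using (1-coprimeTo) renaming (sym to coprime-sym)
import Data.Nat.Properties as ℕₚ
import Data.Nat.Tactic.RingSolver as ℕ-Solver
open import Data.Product using (Σ; ∃₂; _×_; _,_; proj₁; proj₂)
open import Data.Rational using (ℚ; mkℚ; 0ℚ; 1ℚ; _+_; _*_; _-_; -_; _≤_; _<_; ∣_∣; 1/_; _/_; positive; nonNegative)
open import Data.Rational.Properties
open import Data.Sum using (_⊎_; inj₁; inj₂)
open import Data.Vec using (Vec; []; _∷_; lookup; map; zipWith; _[_]≔_)
open import Data.Vec.Properties using (lookup∘tabulate; tabulate∘lookup; tabulate-cong; lookup-map; lookup-zipWith; lookup∘update; lookup∘update′)
open import Defs
open import Level using (0ℓ)
open import Relation.Binary.PropositionalEquality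
open import Relation.Nullary using (¬_; yes; no; Dec; _×-dec_)
open import Relation.Nullary.Decidable using (dec⇒maybe)
open import Tactic.RingSolver using (solve-∀)
open import Tactic.RingSolver.Core.AlmostCommutativeRing using (AlmostCommutativeRing; fromCommutativeRing)

-- Polynomial functions over ℚ and divided differences

ℚ-ring : AlmostCommutativeRing 0ℓ 0ℓ
ℚ-ring = fromCommutativeRing +-*-commutativeRing (λ x → dec⇒maybe (0ℚ ≟ x))

-- Defined by recursion so that induction and the ring solver apply; `ι-/` identifies it with
-- `+ n / 1` for the final inequality.
ι : ℕ → ℚ
ι zero    = 0ℚ
ι (suc n) = 1ℚ + ι n

0≤1 : 0ℚ ≤ 1ℚ
0≤1 = nonNegative⁻¹ 1ℚ

0<1 : 0ℚ < 1ℚ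
0<1 = positive⁻¹ 1ℚ

ι-nonneg : ∀ n → 0ℚ ≤ ι n
ι-nonneg zero    = ≤-refl
ι-nonneg (suc n) = +-mono-≤ 0≤1 (ι-nonneg n)

ι-pos : ∀ n → 0ℚ < ι (suc n)
ι-pos n = +-mono-<-≤ 0<1 (ι-nonneg n)

ι-mono : ∀ {m n} → m ℕ.≤ n → ι m ≤ ι n
ι-mono {n = n} z≤n = ι-nonneg n
ι-mono (s≤s p)     = +-monoʳ-≤ 1ℚ (ι-mono p)

ι-+ : ∀ m n → ι (m ℕ.+ n) ≡ ι m + ι n
ι-+ zero    n = sym (+-identityˡ (ι n))
ι-+ (suc m) n = trans (cong (1ℚ +_) (ι-+ m n)) (sym (+-assoc 1ℚ (ι m) (ι n)))

ι-* : ∀ m n → ι (m ℕ.* n) ≡ ι m * ι n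
ι-* zero    n = sym (*-zeroˡ (ι n))
ι-* (suc m) n = trans (trans (ι-+ n (m ℕ.* n)) (cong (ι n +_) (ι-* m n))) (expand (ι m) (ι n))
  where
  expand : ∀ x y → y + x * y ≡ (1ℚ + x) * y
  expand = solve-∀ ℚ-ring

ι-∸ : ∀ {m n} → m ℕ.≤ n → ι (n ℕ.∸ m) ≡ ι n - ι m
ι-∸ {m} {n} m≤n = trans (cancel (ι m) (ι (n ℕ.∸ m)))
  (cong (_- ι m) (trans (sym (ι-+ m (n ℕ.∸ m))) (cong ι (ℕₚ.m+[n∸m]≡n m≤n))))
  where
  cancel : ∀ x y → y ≡ (x + y) - x
  cancel = solve-∀ ℚ-ring

*-monoˡ-≤ : ∀ {p q r} → 0ℚ ≤ r → p ≤ q → r * p ≤ r * q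
*-monoˡ-≤ {r = r} 0≤r = *-monoˡ-≤-nonNeg r ⦃ nonNegative 0≤r ⦄

*-cancelˡ-≤ : ∀ {p q r} → 0ℚ < r → r * p ≤ r * q → p ≤ q
*-cancelˡ-≤ {r = r} 0<r = *-cancelˡ-≤-pos r ⦃ positive 0<r ⦄

*-pos : ∀ {p q} → 0ℚ < p → 0ℚ < q → 0ℚ < p * q
*-pos {p} {q} 0<p 0<q = positive⁻¹ (p * q) ⦃ pos*pos⇒pos p ⦃ positive 0<p ⦄ q ⦃ positive 0<q ⦄ ⦄

*-nonneg : ∀ {p q} → 0ℚ ≤ p → 0ℚ ≤ q → 0ℚ ≤ p * q
*-nonneg {p} {q} 0≤p 0≤q = nonNegative⁻¹ (p * q) ⦃ nonNeg*nonNeg⇒nonNeg p ⦃ nonNegative 0≤p ⦄ q ⦃ nonNegative 0≤q ⦄ ⦄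

∣*∣-nonneg : ∀ {p} q → 0ℚ ≤ p → ∣ p * q ∣ ≡ p * ∣ q ∣
∣*∣-nonneg {p} q 0≤p = trans (∣p*q∣≡∣p∣*∣q∣ p q) (cong (_* ∣ q ∣) (0≤p⇒∣p∣≡p 0≤p))

reciprocal : ∀ q → 0ℚ < q → Σ ℚ λ r → 0ℚ < r × r * q ≡ 1ℚ
reciprocal q 0<q = 1/ q , positive⁻¹ (1/ q) ⦃ 1/pos⇒pos q ⦄ , *-inverseˡ q
  where instance
  q-pos = positive 0<q
  q-nonZero = pos⇒nonZero q

-- Horner form up to pointwise equality. Only a degree bound and the values are ever used, so no
-- coefficient list is carried along.
Deg : ℕ → (ℚ → ℚ) → Set
Deg zero    f = Σ ℚ λ c → ∀ x → f x ≡ c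
Deg (suc m) f = Σ ℚ λ c → Σ (ℚ → ℚ) λ g → Deg m g × (∀ x → f x ≡ c + x * g x)

Deg-const : ∀ m c → Deg m (λ _ → c)
Deg-const zero    c = c , λ _ → refl
Deg-const (suc m) c = c , _ , Deg-const m 0ℚ , λ x → add-zero c x
  where
  add-zero : ∀ c x → c ≡ c + x * 0ℚ
  add-zero = solve-∀ ℚ-ring

Deg-resp : ∀ m {f g} → (∀ x → f x ≡ g x) → Deg m f → Deg m g
Deg-resp zero    f≗g (c , f≗) = c , λ x → trans (sym (f≗g x)) (f≗ x)
Deg-resp (suc m) f≗g (c , h , deg-h , f≗) = c , h , deg-h , λ x → trans (sym (f≗g x)) (f≗ x)

Deg-suc : ∀ m {f} → Deg m f → Deg (suc m) f
Deg-suc zero    (c , f≗)          = Deg-resp 1 (λ x → sym (f≗ x)) (Deg-const 1 c)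
Deg-suc (suc m) (c , g , dg , f≗) = c , g , Deg-suc m dg , f≗

Deg-mono : ∀ {m n f} → m ℕ.≤ n → Deg m f → Deg n f
Deg-mono {m} {n} {f} m≤n df = subst (λ k → Deg k f) (ℕₚ.m∸n+n≡m m≤n) (raise (n ℕ.∸ m))
  where
  raise : ∀ j → Deg (j ℕ.+ m) f
  raise zero    = df
  raise (suc j) = Deg-suc (j ℕ.+ m) (raise j)

Deg-+ : ∀ m {f g} → Deg m f → Deg m g → Deg m (λ x → f x + g x)
Deg-+ zero    (c , f≗) (d , g≗) = c + d , λ x → cong₂ _+_ (f≗ x) (g≗ x)
Deg-+ (suc m) (c , f′ , df , f≗) (d , g′ , dg , g≗) =
  c + d , _ , Deg-+ m df dg , λ x → trans (cong₂ _+_ (f≗ x) (g≗ x)) (regroup c d x (f′ x) (g′ x))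
  where
  regroup : ∀ c d x y z → (c + x * y) + (d + x * z) ≡ (c + d) + x * (y + z)
  regroup = solve-∀ ℚ-ring

Deg-scale : ∀ m a {f} → Deg m f → Deg m (λ x → a * f x)
Deg-scale zero    a (c , f≗) = a * c , λ x → cong (a *_) (f≗ x)
Deg-scale (suc m) a (c , g , dg , f≗) =
  a * c , _ , Deg-scale m a dg , λ x → trans (cong (a *_) (f≗ x)) (regroup a c x (g x))
  where
  regroup : ∀ a c x y → a * (c + x * y) ≡ a * c + x * (a * y)
  regroup = solve-∀ ℚ-ring

Deg-var* : ∀ m {f} → Deg m f → Deg (suc m) (λ x → x * f x)
Deg-var* m {f} df = 0ℚ , f , df , λ x → sym (+-identityˡ (x * f x))

Deg-affine* : ∀ m a b {f} → Deg m f → Deg (suc m) (λ x → (a + b * x) * f x)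
Deg-affine* m a b {f} df =
  Deg-resp (suc m) (λ x → regroup a b x (f x))
    (Deg-+ (suc m) (Deg-suc m (Deg-scale m a df)) (Deg-scale (suc m) b (Deg-var* m df)))
  where
  regroup : ∀ a b x y → a * y + b * (x * y) ≡ (a + b * x) * y
  regroup = solve-∀ ℚ-ring

Deg-∘affine : ∀ m a b {f} → Deg m f → Deg m (λ x → f (a + b * x))
Deg-∘affine zero    a b (c , f≗) = c , λ x → f≗ (a + b * x)
Deg-∘affine (suc m) a b (c , g , dg , f≗) =
  Deg-resp (suc m) (λ x → sym (f≗ (a + b * x)))
    (Deg-+ (suc m) (Deg-const (suc m) c) (Deg-affine* m a b (Deg-∘affine m a b dg)))

-- Synthetic division: if `f x = c + x * g x` and `g x = g a + (x - a) * h x`, then `g x + a * h x`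
-- is the quotient of `f`.
Deg-quotient : ∀ m a {f} → Deg (suc m) f → Σ (ℚ → ℚ) λ g → Deg m g × (∀ x → f x ≡ f a + (x - a) * g x)
Deg-quotient zero a {f} (c , g , (d , g≗) , f≗) = (λ _ → d) , Deg-const 0 d , λ x →
  trans (f≗ x) (trans (cong (λ y → c + x * y) (g≗ x))
    (trans (regroup c x a d) (cong (_+ (x - a) * d) (sym (trans (f≗ a) (cong (λ y → c + a * y) (g≗ a)))))))
  where
  regroup : ∀ c x a d → c + x * d ≡ (c + a * d) + (x - a) * d
  regroup = solve-∀ ℚ-ring
Deg-quotient (suc m) a {f} (c , g , dg , f≗) with Deg-quotient m a dg
... | h , dh , g≗ = _ , Deg-+ (suc m) dg (Deg-suc m (Deg-scale m a dh)) , λ x →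
  trans (f≗ x) (trans (regroup c x a (g x) (h x) (g a) (g≗ x)) (cong (_+ (x - a) * (g x + a * h x)) (sym (f≗ a))))
  where
  expand : ∀ c x a y z → c + x * (z + (x - a) * y) ≡ (c + a * z) + (x - a) * ((z + (x - a) * y) + a * y)
  expand = solve-∀ ℚ-ring
  regroup : ∀ c x a gx hx ga → gx ≡ ga + (x - a) * hx → c + x * gx ≡ (c + a * ga) + (x - a) * (gx + a * hx)
  regroup c x a _ hx ga refl = expand c x a hx ga

-- δ s i is the inverse of the gap between the extreme nodes of the divided difference of order s + 1 at i.
module DividedDifference
  (x : ℕ → ℚ) (δ : ℕ → ℕ → ℚ)
  (δ-inverse : ∀ s i → δ s i * (x (suc (s ℕ.+ i)) - x i) ≡ 1ℚ)
  where

  dd : ℕ → ℕ → (ℕ → ℚ) → ℚ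
  dd zero    i F = F i
  dd (suc s) i F = δ s i * (dd s (suc i) F - dd s i F)

  dd-cong : ∀ s i {F G} → (∀ j → F j ≡ G j) → dd s i F ≡ dd s i G
  dd-cong zero    i F≗G = F≗G i
  dd-cong (suc s) i F≗G = cong₂ (λ p q → δ s i * (p - q)) (dd-cong s (suc i) F≗G) (dd-cong s i F≗G)

  dd-+ : ∀ s i F G → dd s i (λ j → F j + G j) ≡ dd s i F + dd s i G
  dd-+ zero    i F G = refl
  dd-+ (suc s) i F G = trans (cong₂ (λ p q → δ s i * (p - q)) (dd-+ s (suc i) F G) (dd-+ s i F G))
    (regroup (δ s i) (dd s (suc i) F) (dd s (suc i) G) (dd s i F) (dd s i G))
    where
    regroup : ∀ d p q r t → d * ((p + q) - (r + t)) ≡ d * (p - r) + d * (q - t)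
    regroup = solve-∀ ℚ-ring

  dd-const : ∀ s i c → dd (suc s) i (λ _ → c) ≡ 0ℚ
  dd-const zero    i c = vanish (δ 0 i) c
    where
    vanish : ∀ d c → d * (c - c) ≡ 0ℚ
    vanish = solve-∀ ℚ-ring
  dd-const (suc s) i c =
    trans (cong₂ (λ p q → δ (suc s) i * (p - q)) (dd-const s (suc i) c) (dd-const s i c)) (vanish (δ (suc s) i))
    where
    vanish : ∀ d → d * (0ℚ - 0ℚ) ≡ 0ℚ
    vanish = solve-∀ ℚ-ring

  dd-gap : ∀ s i F → (x (suc (s ℕ.+ i)) - x i) * dd (suc s) i F ≡ dd s (suc i) F - dd s i F
  dd-gap s i F = trans (regroup (x (suc (s ℕ.+ i)) - x i) (δ s i) D)
    (trans (cong (_* D) (δ-inverse s i)) (*-identityˡ D))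
    where
    D = dd s (suc i) F - dd s i F
    regroup : ∀ g d p → g * (d * p) ≡ (d * g) * p
    regroup = solve-∀ ℚ-ring

  -- Leibniz rule for the product with the node function, whose divided differences are `x i` at
  -- order 0, 1 at order 1 and 0 beyond.
  dd-Leibniz : ∀ s i F → dd (suc s) i (λ j → x j * F j) ≡ x i * dd (suc s) i F + dd s (suc i) F
  dd-Leibniz zero i F =
    trans (regroup (δ 0 i) (x (suc i)) (x i) (F (suc i)) (F i))
      (cong (x i * (δ 0 i * (F (suc i) - F i)) +_)
        (trans (cong (_* F (suc i)) (δ-inverse 0 i)) (*-identityˡ (F (suc i)))))
    where
    regroup : ∀ d y z p q → d * (y * p - z * q) ≡ z * (d * (p - q)) + (d * (y - z)) * p
    regroup = solve-∀ ℚ-ring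
  dd-Leibniz (suc s) i F = begin
    δ (suc s) i * (dd (suc s) (suc i) (λ j → x j * F j) - dd (suc s) i (λ j → x j * F j))
      ≡⟨ cong₂ (λ p q → δ (suc s) i * (p - q)) (dd-Leibniz s (suc i) F) (dd-Leibniz s i F) ⟩
    δ (suc s) i * ((x (suc i) * A + C) - (x i * B + D))
      ≡⟨ regroup₁ (δ (suc s) i) (x (suc i)) (x i) A B C D ⟩
    x i * (δ (suc s) i * (A - B)) + δ (suc s) i * ((x (suc i) - x i) * A + (C - D))
      ≡⟨ cong (λ y → x i * (δ (suc s) i * (A - B)) + δ (suc s) i * ((x (suc i) - x i) * A + y)) (sym (dd-gap s (suc i) F)) ⟩
    x i * (δ (suc s) i * (A - B)) + δ (suc s) i * ((x (suc i) - x i) * A + (x (suc (s ℕ.+ suc i)) - x (suc i)) * A)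
      ≡⟨ cong (x i * (δ (suc s) i * (A - B)) +_) (regroup₂ (δ (suc s) i) (x (suc i)) (x i) (x (suc (s ℕ.+ suc i))) A) ⟩
    x i * (δ (suc s) i * (A - B)) + (δ (suc s) i * (x (suc (s ℕ.+ suc i)) - x i)) * A
      ≡⟨ cong (λ j → x i * (δ (suc s) i * (A - B)) + (δ (suc s) i * (x (suc j) - x i)) * A) (ℕₚ.+-suc s i) ⟩
    x i * (δ (suc s) i * (A - B)) + (δ (suc s) i * (x (suc (suc s ℕ.+ i)) - x i)) * A
      ≡⟨ cong (λ y → x i * (δ (suc s) i * (A - B)) + y * A) (δ-inverse (suc s) i) ⟩
    x i * (δ (suc s) i * (A - B)) + 1ℚ * A
      ≡⟨ cong (x i * (δ (suc s) i * (A - B)) +_) (*-identityˡ A) ⟩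
    x i * (δ (suc s) i * (A - B)) + A ∎
    where
    open ≡-Reasoning
    A = dd (suc s) (suc i) F
    B = dd (suc s) i F
    C = dd s (suc (suc i)) F
    D = dd s (suc i) F
    regroup₁ : ∀ d y z a b p q → d * ((y * a + p) - (z * b + q)) ≡ z * (d * (a - b)) + d * ((y - z) * a + (p - q))
    regroup₁ = solve-∀ ℚ-ring
    regroup₂ : ∀ d y z w a → d * ((y - z) * a + (w - y) * a) ≡ (d * (w - z)) * a
    regroup₂ = solve-∀ ℚ-ring

  -- Induction along the Horner form: the constant vanishes, and by `dd-Leibniz` a factor `x` lowers
  -- the order of the difference by at most one.
  dd-Deg : ∀ m s i {f} → Deg m f → m ℕ.< s → dd s i (λ j → f (x j)) ≡ 0ℚ
  dd-Deg zero (suc s) i (c , f≗) _ = trans (dd-cong (suc s) i (λ j → f≗ (x j))) (dd-const s i c)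
  dd-Deg (suc m) (suc s) i {f} (c , g , dg , f≗) (s≤s m<s) = begin
    dd (suc s) i (λ j → f (x j))
      ≡⟨ dd-cong (suc s) i (λ j → f≗ (x j)) ⟩
    dd (suc s) i (λ j → c + x j * g (x j))
      ≡⟨ dd-+ (suc s) i (λ _ → c) (λ j → x j * g (x j)) ⟩
    dd (suc s) i (λ _ → c) + dd (suc s) i (λ j → x j * g (x j))
      ≡⟨ cong₂ _+_ (dd-const s i c) (dd-Leibniz s i (λ j → g (x j))) ⟩
    0ℚ + (x i * dd (suc s) i (λ j → g (x j)) + dd s (suc i) (λ j → g (x j)))
      ≡⟨ cong₂ (λ p q → 0ℚ + (x i * p + q)) (dd-Deg m (suc s) i dg (ℕₚ.m<n⇒m<1+n m<s)) (dd-Deg m s (suc i) dg m<s) ⟩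
    0ℚ + (x i * 0ℚ + 0ℚ)
      ≡⟨ vanish (x i) ⟩
    0ℚ ∎
    where
    open ≡-Reasoning
    vanish : ∀ y → 0ℚ + (y * 0ℚ + 0ℚ) ≡ 0ℚ
    vanish = solve-∀ ℚ-ring

-- Extrapolation to 0 from the pronic numbers

pronic : ℕ → ℚ
pronic i = ι i * (1ℚ + ι i)

-- The nodes `i (i + 1)` spread quadratically, like Chebyshev nodes near an end point, and `j (j +
-- 1) - i (i + 1) = (j - i) (j + i + 1)` makes the weights of divided differences explicit products.
pronic-gap : ∀ s i → pronic (suc (s ℕ.+ i)) - pronic i ≡ ι (suc s) * (ι (suc s) + (1ℚ + (ι i + ι i)))
pronic-gap s i rewrite ι-+ s i = factor (ι s) (ι i)
  where
  factor : ∀ a b → (1ℚ + (a + b)) * (1ℚ + (1ℚ + (a + b))) - b * (1ℚ + b) ≡ (1ℚ + a) * ((1ℚ + a) + (1ℚ + (b + b)))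
  factor = solve-∀ ℚ-ring

pronic-gap-pos : ∀ s i → 0ℚ < pronic (suc (s ℕ.+ i)) - pronic i
pronic-gap-pos s i rewrite pronic-gap s i =
  *-pos (ι-pos s) (+-mono-<-≤ (ι-pos s) (+-mono-≤ 0≤1 (+-mono-≤ (ι-nonneg i) (ι-nonneg i))))

pronic-δ : ℕ → ℕ → ℚ
pronic-δ s i = proj₁ (reciprocal _ (pronic-gap-pos s i))

pronic-δ-inverse : ∀ s i → pronic-δ s i * (pronic (suc (s ℕ.+ i)) - pronic i) ≡ 1ℚ
pronic-δ-inverse s i = proj₂ (proj₂ (reciprocal _ (pronic-gap-pos s i)))

module Pronic = DividedDifference pronic pronic-δ pronic-δ-inverse

-- ρ s i = s! (i+1) ⋯ (i+s) is the reciprocal of the sum of the absolute values of the weights of dd s i.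
ρ : ℕ → ℕ → ℚ
ρ zero    i = 1ℚ
ρ (suc s) i = ι (suc s) * ι (suc i) * ρ s (suc i)

-- Peels off the last factor instead of the first; `scaled-dd-suc` needs both forms, as its two
-- terms start at `suc i` and at `i`.
ρ-last : ∀ s i → ρ (suc s) i ≡ ι (suc s) * ι (suc (s ℕ.+ i)) * ρ s i
ρ-last zero    i = refl
ρ-last (suc s) i = begin
  ι (suc (suc s)) * ι (suc i) * ρ (suc s) (suc i)
    ≡⟨ cong (ι (suc (suc s)) * ι (suc i) *_) (ρ-last s (suc i)) ⟩
  ι (suc (suc s)) * ι (suc i) * (ι (suc s) * ι (suc (s ℕ.+ suc i)) * ρ s (suc i))
    ≡⟨ cong (λ j → ι (suc (suc s)) * ι (suc i) * (ι (suc s) * ι (suc j) * ρ s (suc i))) (ℕₚ.+-suc s i) ⟩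
  ι (suc (suc s)) * ι (suc i) * (ι (suc s) * ι (suc (suc s ℕ.+ i)) * ρ s (suc i))
    ≡⟨ permute (ι (suc (suc s))) (ι (suc i)) (ι (suc s)) (ι (suc (suc s ℕ.+ i))) (ρ s (suc i)) ⟩
  ι (suc (suc s)) * ι (suc (suc s ℕ.+ i)) * (ι (suc s) * ι (suc i) * ρ s (suc i)) ∎
  where
  open ≡-Reasoning
  permute : ∀ a b c d e → a * b * (c * d * e) ≡ a * d * (c * b * e)
  permute = solve-∀ ℚ-ring

module _ (F : ℕ → ℚ) where

  scaled-dd : ℕ → ℕ → ℚ
  scaled-dd s i = ρ s i * Pronic.dd s i F

  -- Up to sign, scaled-dd (suc s) i is a convex combination of scaled-dd s (suc i) and scaled-dd s i.
  scaled-dd-suc : ∀ s i → (ι (suc s) + (1ℚ + (ι i + ι i))) * scaled-dd (suc s) i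
                        ≡ ι (suc i) * scaled-dd s (suc i) - ι (suc (s ℕ.+ i)) * scaled-dd s i
  scaled-dd-suc s i = begin
    g * (ρ (suc s) i * (d * (A - B)))
      ≡⟨ split g (ρ (suc s) i) d A B ⟩
    (d * g) * (ρ (suc s) i * A) - (d * g) * (ρ (suc s) i * B)
      ≡⟨ cong (λ y → (d * g) * (ρ (suc s) i * A) - (d * g) * (y * B)) (ρ-last s i) ⟩
    (d * g) * (ι (suc s) * ι (suc i) * ρ s (suc i) * A) - (d * g) * (ι (suc s) * ι (suc (s ℕ.+ i)) * ρ s i * B)
      ≡⟨ collect d g (ι (suc s)) (ι (suc i)) (ι (suc (s ℕ.+ i))) (ρ s (suc i)) (ρ s i) A B ⟩
    (d * (ι (suc s) * g)) * (ι (suc i) * (ρ s (suc i) * A) - ι (suc (s ℕ.+ i)) * (ρ s i * B))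
      ≡⟨ cong (λ y → (d * y) * (ι (suc i) * (ρ s (suc i) * A) - ι (suc (s ℕ.+ i)) * (ρ s i * B))) (sym (pronic-gap s i)) ⟩
    (d * (pronic (suc (s ℕ.+ i)) - pronic i)) * (ι (suc i) * (ρ s (suc i) * A) - ι (suc (s ℕ.+ i)) * (ρ s i * B))
      ≡⟨ cong (_* (ι (suc i) * (ρ s (suc i) * A) - ι (suc (s ℕ.+ i)) * (ρ s i * B))) (pronic-δ-inverse s i) ⟩
    1ℚ * (ι (suc i) * (ρ s (suc i) * A) - ι (suc (s ℕ.+ i)) * (ρ s i * B))
      ≡⟨ *-identityˡ _ ⟩
    ι (suc i) * (ρ s (suc i) * A) - ι (suc (s ℕ.+ i)) * (ρ s i * B) ∎
    where
    open ≡-Reasoning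
    g = ι (suc s) + (1ℚ + (ι i + ι i))
    d = pronic-δ s i
    A = Pronic.dd s (suc i) F
    B = Pronic.dd s i F
    split : ∀ g r d a b → g * (r * (d * (a - b))) ≡ (d * g) * (r * a) - (d * g) * (r * b)
    split = solve-∀ ℚ-ring
    collect : ∀ d g t u v r q a b →
      (d * g) * (t * u * r * a) - (d * g) * (t * v * q * b) ≡ (d * (t * g)) * (u * (r * a) - v * (q * b))
    collect = solve-∀ ℚ-ring

  module _ (r : ℕ) (ε : ℚ) (F-bound : ∀ i → suc i ℕ.≤ r → ∣ F (suc i) ∣ ≤ ε) where

    -- The coefficients on the right of `scaled-dd-suc` add up in absolute value to the one on the
    -- left, so the bound `ε` is inherited. The base index `suc i` keeps out node 0, where nothing
    -- bounds `F`.
    scaled-dd-bound : ∀ s i → s ℕ.+ suc i ℕ.≤ r → ∣ scaled-dd s (suc i) ∣ ≤ ε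
    scaled-dd-bound zero i i<r = ≤-trans (≤-reflexive (cong ∣_∣ (*-identityˡ (F (suc i))))) (F-bound i i<r)
    scaled-dd-bound (suc s) i s+i<r = *-cancelˡ-≤ 0<g (begin
      g * ∣ scaled-dd (suc s) (suc i) ∣
        ≡⟨ ∣*∣-nonneg (scaled-dd (suc s) (suc i)) (<⇒≤ 0<g) ⟨
      ∣ g * scaled-dd (suc s) (suc i) ∣
        ≡⟨ cong ∣_∣ (scaled-dd-suc s (suc i)) ⟩
      ∣ a * scaled-dd s (suc (suc i)) - b * scaled-dd s (suc i) ∣
        ≤⟨ ∣p-q∣≤∣p∣+∣q∣ (a * scaled-dd s (suc (suc i))) (b * scaled-dd s (suc i)) ⟩
      ∣ a * scaled-dd s (suc (suc i)) ∣ + ∣ b * scaled-dd s (suc i) ∣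
        ≡⟨ cong₂ _+_ (∣*∣-nonneg (scaled-dd s (suc (suc i))) (ι-nonneg (suc (suc i))))
                     (∣*∣-nonneg (scaled-dd s (suc i)) (ι-nonneg (suc (s ℕ.+ suc i)))) ⟩
      a * ∣ scaled-dd s (suc (suc i)) ∣ + b * ∣ scaled-dd s (suc i) ∣
        ≤⟨ +-mono-≤ (*-monoˡ-≤ (ι-nonneg (suc (suc i))) (scaled-dd-bound s (suc i) (subst (ℕ._≤ r) (sym (ℕₚ.+-suc s (suc i))) s+i<r)))
                    (*-monoˡ-≤ (ι-nonneg (suc (s ℕ.+ suc i))) (scaled-dd-bound s i (ℕₚ.<⇒≤ s+i<r))) ⟩
      a * ε + b * ε
        ≡⟨ cong (λ y → a * ε + (1ℚ + y) * ε) (ι-+ s (suc i)) ⟩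
      a * ε + (1ℚ + (ι s + ι (suc i))) * ε
        ≡⟨ collect (ι s) (ι i) ε ⟩
      g * ε ∎)
      where
      open ≤-Reasoning
      g = ι (suc s) + (1ℚ + (ι (suc i) + ι (suc i)))
      a = ι (suc (suc i))
      b = ι (suc (s ℕ.+ suc i))
      0<g : 0ℚ < g
      0<g = +-mono-<-≤ (ι-pos s) (+-mono-≤ 0≤1 (+-mono-≤ (ι-nonneg (suc i)) (ι-nonneg (suc i))))
      collect : ∀ s i e → (1ℚ + (1ℚ + i)) * e + (1ℚ + (s + (1ℚ + i))) * e ≡ ((1ℚ + s) + (1ℚ + ((1ℚ + i) + (1ℚ + i)))) * e
      collect = solve-∀ ℚ-ring

    private
      -- At `i = 0` the coefficients in `scaled-dd-suc` are `s + 2`, 1 and `s + 1`. In this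
      -- normalisation the recursion reads `Λ (suc s) = scaled-dd s 1 - Λ s`, so each order costs at
      -- most one `ε`.
      Λ : ℕ → ℚ
      Λ s = ι (suc s) * scaled-dd s 0

      Λ-suc : ∀ s → Λ s ≡ scaled-dd s 1 - Λ (suc s)
      Λ-suc s = trans (isolate (scaled-dd s 1) (Λ s)) (cong (λ y → scaled-dd s 1 - y) (sym step))
        where
        isolate : ∀ u y → y ≡ u - (u - y)
        isolate = solve-∀ ℚ-ring
        normalise : ∀ g v → (1ℚ + g) * v ≡ (g + (1ℚ + (0ℚ + 0ℚ))) * v
        normalise = solve-∀ ℚ-ring
        unit : ∀ u → (1ℚ + 0ℚ) * u ≡ u
        unit = solve-∀ ℚ-ring
        step : Λ (suc s) ≡ scaled-dd s 1 - Λ s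
        step = trans (normalise (ι (suc s)) (scaled-dd (suc s) 0))
          (trans (scaled-dd-suc s 0)
            (cong₂ _-_ (unit (scaled-dd s 1)) (cong (λ j → ι (suc j) * scaled-dd s 0) (ℕₚ.+-identityʳ s))))

      Λ-bound : ∀ s → s ℕ.≤ r → ∣ F 0 ∣ ≤ ι s * ε + ∣ Λ s ∣
      Λ-bound zero _ = ≤-reflexive (trans (cong ∣_∣ (unit (F 0))) (zero-mul ε (∣ Λ 0 ∣)))
        where
        unit : ∀ y → y ≡ (1ℚ + 0ℚ) * (1ℚ * y)
        unit = solve-∀ ℚ-ring
        zero-mul : ∀ e y → y ≡ 0ℚ * e + y
        zero-mul = solve-∀ ℚ-ring
      Λ-bound (suc s) s<r = begin
        ∣ F 0 ∣                                     ≤⟨ Λ-bound s (ℕₚ.<⇒≤ s<r) ⟩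
        ι s * ε + ∣ Λ s ∣                           ≡⟨ cong (λ y → ι s * ε + ∣ y ∣) (Λ-suc s) ⟩
        ι s * ε + ∣ scaled-dd s 1 - Λ (suc s) ∣     ≤⟨ +-monoʳ-≤ (ι s * ε) (∣p-q∣≤∣p∣+∣q∣ (scaled-dd s 1) (Λ (suc s))) ⟩
        ι s * ε + (∣ scaled-dd s 1 ∣ + ∣ Λ (suc s) ∣)
          ≤⟨ +-monoʳ-≤ (ι s * ε) (+-monoˡ-≤ (∣ Λ (suc s) ∣) (scaled-dd-bound s 0 (subst (ℕ._≤ r) (ℕₚ.+-comm 1 s) s<r))) ⟩
        ι s * ε + (ε + ∣ Λ (suc s) ∣)               ≡⟨ collect (ι s) ε (∣ Λ (suc s) ∣) ⟩
        ι (suc s) * ε + ∣ Λ (suc s) ∣               ∎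
        where
        open ≤-Reasoning
        collect : ∀ s e y → s * e + (e + y) ≡ (1ℚ + s) * e + y
        collect = solve-∀ ℚ-ring

    -- `F 0` is `Λ 0`, and the hypothesis makes `Λ r` vanish. The factor `r` is the exact sum of the
    -- absolute Lagrange weights at 0; equally spaced nodes would give `2 ^ r - 1`.
    pronic-extrapolation : Pronic.dd r 0 F ≡ 0ℚ → ∣ F 0 ∣ ≤ ι r * ε
    pronic-extrapolation dd≡0 = ≤-trans (Λ-bound r ℕₚ.≤-refl) (≤-reflexive (trans (cong (λ y → ι r * ε + ∣ y ∣) Λ≡0) (+-identityʳ (ι r * ε))))
      where
      vanish : ∀ a b → a * (b * 0ℚ) ≡ 0ℚ
      vanish = solve-∀ ℚ-ring
      Λ≡0 : Λ r ≡ 0ℚ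
      Λ≡0 = trans (cong (λ y → ι (suc r) * (ρ r 0 * y)) dd≡0) (vanish (ι (suc r)) (ρ r 0))

Deg-extrapolation : ∀ m ε {f} → Deg m f → (∀ i → suc i ℕ.≤ suc m → ∣ f (pronic (suc i)) ∣ ≤ ε) →
                    ∣ f 0ℚ ∣ ≤ ι (suc m) * ε
Deg-extrapolation m ε {f} df bound =
  pronic-extrapolation (λ i → f (pronic i)) (suc m) ε bound (Pronic.dd-Deg m (suc m) 0 df ℕₚ.≤-refl)

-- Markov-type inequality and alternation

third : ℚ
third = ℤ.+ 1 / 3

0<third : 0ℚ < third
0<third = positive⁻¹ third

third<1 : third < 1ℚ
third<1 = subst (_< 1ℚ) (+-identityʳ third) (+-monoʳ-< third (positive⁻¹ (ℤ.+ 2 / 3)))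

-- The largest node `(m + 3) i (i + 1)` that `Deg-no-jump` uses, attained at `i = m + 1`.
run : ℕ → ℕ
run m = suc (suc (suc m)) ℕ.* (suc m ℕ.* suc (suc m))

-- A Markov-type inequality. Put F x = f (a + e x) and F x = F 1 + (x - 1) g x. Then |g 0| ≥ 2/3, while g is
-- small at the nodes (m + 3) i (i + 1), i = 1, …, m + 1; extrapolating from these to 0 gives a contradiction.
Deg-no-jump : ∀ m a e {f} → Deg (suc m) f → 1ℚ ≤ ∣ f a ∣ →
              (∀ j → 1 ℕ.≤ j → j ℕ.≤ run m → ∣ f (a + e * ι j) ∣ ≤ third) → ⊥
Deg-no-jump m a e {f} df large small = <-irrefl refl (<-≤-trans strict (≤-trans G0-lower G0-upper))
  where
  F : ℚ → ℚ
  F x = f (a + e * x)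
  quotient = Deg-quotient m 1ℚ (Deg-∘affine (suc m) a e df)
  g = proj₁ quotient
  F-split : ∀ x → F x ≡ F 1ℚ + (x - 1ℚ) * g x
  F-split = proj₂ (proj₂ quotient)
  -- The nodes are positive multiples of `c`, so their distance from 1 is at least `m + 2`. Dividing
  -- by it gains slightly more than the factor `m + 1` that the extrapolation loses.
  c = suc (suc (suc m))
  G : ℚ → ℚ
  G x = ι (suc (suc m)) * g (0ℚ + ι c * x)
  dG : Deg m G
  dG = Deg-scale m (ι (suc (suc m))) (Deg-∘affine m 0ℚ (ι c) (proj₁ (proj₂ quotient)))
  τ = third + third

  F1-small : ∣ F 1ℚ ∣ ≤ third
  F1-small = small 1 ℕₚ.≤-refl (s≤s z≤n)

  G-small : ∀ i → suc i ℕ.≤ suc m → ∣ G (pronic (suc i)) ∣ ≤ τ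
  G-small i i≤m = begin
    ∣ ι (suc (suc m)) * g (0ℚ + ι c * pronic (suc i)) ∣
      ≡⟨ cong (λ y → ∣ ι (suc (suc m)) * g y ∣) X≡ ⟩
    ∣ ι (suc (suc m)) * g X ∣       ≡⟨ ∣*∣-nonneg (g X) (ι-nonneg (suc (suc m))) ⟩
    ι (suc (suc m)) * ∣ g X ∣       ≤⟨ *-monoʳ-≤-nonNeg (∣ g X ∣) ⦃ ∣-∣-nonNeg (g X) ⦄ far ⟩
    (X - 1ℚ) * ∣ g X ∣              ≡⟨ ∣*∣-nonneg (g X) (≤-trans (ι-nonneg (suc (suc m))) far) ⟨
    ∣ (X - 1ℚ) * g X ∣              ≡⟨ cong ∣_∣ (trans (isolate (F 1ℚ) ((X - 1ℚ) * g X)) (cong (_- F 1ℚ) (sym (F-split X)))) ⟩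
    ∣ F X - F 1ℚ ∣                  ≤⟨ ∣p-q∣≤∣p∣+∣q∣ (F X) (F 1ℚ) ⟩
    ∣ F X ∣ + ∣ F 1ℚ ∣              ≤⟨ +-mono-≤ (small M 1≤M M≤run) F1-small ⟩
    τ                               ∎
    where
    open ≤-Reasoning
    M = c ℕ.* (suc i ℕ.* suc (suc i))
    X = ι M
    1≤M : 1 ℕ.≤ M
    1≤M = s≤s z≤n
    M≤run : M ℕ.≤ run m
    M≤run = ℕₚ.*-monoʳ-≤ c (ℕₚ.*-mono-≤ i≤m (s≤s i≤m))
    X≡ : 0ℚ + ι c * pronic (suc i) ≡ X
    X≡ = trans (+-identityˡ (ι c * pronic (suc i)))
      (sym (trans (ι-* c (suc i ℕ.* suc (suc i))) (cong (ι c *_) (ι-* (suc i) (suc (suc i))))))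
    isolate : ∀ x y → y ≡ (x + y) - x
    isolate = solve-∀ ℚ-ring
    drop : ∀ x → x ≡ (1ℚ + x) - 1ℚ
    drop = solve-∀ ℚ-ring
    far : ι (suc (suc m)) ≤ X - 1ℚ
    far = ≤-trans (≤-reflexive (drop (ι (suc (suc m))))) (+-monoˡ-≤ (- 1ℚ) (ι-mono {c} {M} (ℕₚ.m≤m*n c (suc i ℕ.* suc (suc i)))))

  G0-upper : ∣ G 0ℚ ∣ ≤ ι (suc m) * τ
  G0-upper = Deg-extrapolation m τ dG G-small

  g0-lower : τ ≤ ∣ g 0ℚ ∣
  g0-lower = begin
    τ                                ≡⟨⟩
    - third + 1ℚ                     ≤⟨ +-monoʳ-≤ (- third) large ⟩
    - third + ∣ f a ∣                ≡⟨ cong (λ y → - third + ∣ f y ∣) (at-zero a e) ⟩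
    - third + ∣ F 0ℚ ∣               ≡⟨ cong (λ y → - third + ∣ y ∣) (trans (F-split 0ℚ) (simplify (F 1ℚ) (g 0ℚ))) ⟩
    - third + ∣ F 1ℚ - g 0ℚ ∣        ≤⟨ +-monoʳ-≤ (- third) (∣p-q∣≤∣p∣+∣q∣ (F 1ℚ) (g 0ℚ)) ⟩
    - third + (∣ F 1ℚ ∣ + ∣ g 0ℚ ∣)  ≤⟨ +-monoʳ-≤ (- third) (+-monoˡ-≤ (∣ g 0ℚ ∣) F1-small) ⟩
    - third + (third + ∣ g 0ℚ ∣)     ≡⟨ cancel third (∣ g 0ℚ ∣) ⟩
    ∣ g 0ℚ ∣                         ∎
    where
    open ≤-Reasoning
    at-zero : ∀ a e → a ≡ a + e * 0ℚ
    at-zero = solve-∀ ℚ-ring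
    simplify : ∀ x y → x + (0ℚ - 1ℚ) * y ≡ x - y
    simplify = solve-∀ ℚ-ring
    cancel : ∀ t y → - t + (t + y) ≡ y
    cancel = solve-∀ ℚ-ring

  G0-lower : ι (suc (suc m)) * τ ≤ ∣ G 0ℚ ∣
  G0-lower = begin
    ι (suc (suc m)) * τ                          ≤⟨ *-monoˡ-≤ (ι-nonneg (suc (suc m))) g0-lower ⟩
    ι (suc (suc m)) * ∣ g 0ℚ ∣                   ≡⟨ cong (λ y → ι (suc (suc m)) * ∣ g y ∣) (at-zero (ι c)) ⟩
    ι (suc (suc m)) * ∣ g (0ℚ + ι c * 0ℚ) ∣      ≡⟨ ∣*∣-nonneg (g (0ℚ + ι c * 0ℚ)) (ι-nonneg (suc (suc m))) ⟨
    ∣ G 0ℚ ∣                                     ∎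
    where
    open ≤-Reasoning
    at-zero : ∀ c → 0ℚ ≡ 0ℚ + c * 0ℚ
    at-zero = solve-∀ ℚ-ring

  strict : ι (suc m) * τ < ι (suc (suc m)) * τ
  strict = subst₂ _<_ (+-identityˡ (ι (suc m) * τ)) (sym (distrib (ι (suc m)) τ))
    (+-monoˡ-< (ι (suc m) * τ) (+-mono-< 0<third 0<third))
    where
    distrib : ∀ x y → (1ℚ + x) * y ≡ y + x * y
    distrib = solve-∀ ℚ-ring

signed : Bool → ℚ → ℚ
signed true  p = p
signed false p = - p

signed-difference : ∀ b {d p q} → 0ℚ < d → 0ℚ < signed (not b) p → 0ℚ < signed b q →
                    0ℚ < signed (not b) (d * (p - q))
signed-difference true {d} {p} {q} 0<d 0<p 0<q = subst (0ℚ <_) (rearrange d p q) (*-pos 0<d (+-mono-< 0<p 0<q))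
  where
  rearrange : ∀ d p q → d * (- p + q) ≡ - (d * (p - q))
  rearrange = solve-∀ ℚ-ring
signed-difference false 0<d 0<p 0<q = *-pos 0<d (+-mono-< 0<p 0<q)

-- With alternating signs, the two terms of each difference reinforce each other, so a divided
-- difference has the sign of the value at its last node. At order `m + 1` this contradicts
-- `dd-Deg`; no real roots are involved.
Deg-no-alternation : ∀ m {f} → Deg m f → (node : ℕ → ℕ) → (∀ j → node j ℕ.< node (suc j)) → (sign : ℕ → Bool) →
  (∀ j → j ℕ.≤ suc m → 0ℚ < signed (sign j) (f (ι (node j)))) →
  (∀ j → j ℕ.< suc m → sign (suc j) ≡ not (sign j)) → ⊥
Deg-no-alternation m {f} df node increasing sign has-sign alternates =
  <-irrefl refl (subst (0ℚ <_) (trans (cong (signed (sign (suc m ℕ.+ 0))) (DD.dd-Deg m (suc m) 0 df ℕₚ.≤-refl)) (signed-zero (sign (suc m ℕ.+ 0))))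
    (dd-sign (suc m) 0 (ℕₚ.≤-reflexive (ℕₚ.+-identityʳ (suc m)))))
  where
  signed-zero : ∀ b → signed b 0ℚ ≡ 0ℚ
  signed-zero true  = refl
  signed-zero false = refl
  node-< : ∀ s i → node i ℕ.< node (suc (s ℕ.+ i))
  node-< zero    i = increasing i
  node-< (suc s) i = ℕₚ.<-trans (node-< s i) (increasing (suc (s ℕ.+ i)))
  gap-pos : ∀ s i → 0ℚ < ι (node (suc (s ℕ.+ i))) - ι (node i)
  gap-pos s i = subst (0ℚ <_) (ι-∸ (ℕₚ.<⇒≤ (node-< s i)))
    (<-≤-trans (ι-pos 0) (ι-mono (ℕₚ.m<n⇒0<n∸m (node-< s i))))
  δ-spec = λ s i → reciprocal _ (gap-pos s i)
  module DD = DividedDifference (λ j → ι (node j)) (λ s i → proj₁ (δ-spec s i)) (λ s i → proj₂ (proj₂ (δ-spec s i)))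
  F : ℕ → ℚ
  F j = f (ι (node j))
  dd-sign : ∀ s i → s ℕ.+ i ℕ.≤ suc m → 0ℚ < signed (sign (s ℕ.+ i)) (DD.dd s i F)
  dd-sign zero    i i≤ = has-sign i i≤
  dd-sign (suc s) i s+i≤ = subst (λ b → 0ℚ < signed b (DD.dd (suc s) i F)) (sym alt)
    (signed-difference (sign (s ℕ.+ i)) (proj₁ (proj₂ (δ-spec s i)))
      (subst (λ b → 0ℚ < signed b (DD.dd s (suc i) F)) (trans (cong sign (ℕₚ.+-suc s i)) alt)
        (dd-sign s (suc i) (subst (ℕ._≤ suc m) (sym (ℕₚ.+-suc s i)) s+i≤)))
      (dd-sign s i (ℕₚ.<⇒≤ s+i≤)))
    where
    alt : sign (suc (s ℕ.+ i)) ≡ not (sign (s ℕ.+ i))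
    alt = alternates (s ℕ.+ i) s+i≤

≢⇒≡not : ∀ {a b : Bool} → a ≢ b → a ≡ not b
≢⇒≡not {true}  {true}  a≢b = ⊥-elim (a≢b refl)
≢⇒≡not {true}  {false} a≢b = refl
≢⇒≡not {false} {true}  a≢b = refl
≢⇒≡not {false} {false} a≢b = ⊥-elim (a≢b refl)

-- These are the properties of the symmetrised squares of the approximating polynomials.
record Separates (m N : ℕ) (val : ℕ → Bool) (Q : Bool → ℚ → ℚ) : Set where
  field
    deg   : ∀ c → Deg (suc m) (Q c)
    large : ∀ w → w ℕ.≤ N → 1ℚ ≤ Q (val w) (ι w)
    pos   : ∀ w → w ℕ.≤ N → 0ℚ ≤ Q (not (val w)) (ι w)
    small : ∀ w → w ℕ.≤ N → Q (not (val w)) (ι w) ≤ third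

  ∣large∣ : ∀ {c} w → w ℕ.≤ N → val w ≡ c → 1ℚ ≤ ∣ Q c (ι w) ∣
  ∣large∣ w w≤N refl = subst (1ℚ ≤_) (sym (0≤p⇒∣p∣≡p (≤-trans 0≤1 (large w w≤N)))) (large w w≤N)

  ∣small∣ : ∀ {c} w → w ℕ.≤ N → val w ≡ c → ∣ Q (not c) (ι w) ∣ ≤ third
  ∣small∣ w w≤N refl = subst (_≤ third) (sym (0≤p⇒∣p∣≡p (pos w w≤N))) (small w w≤N)

  -- `Q (not b)` is at least 1 at `N` and at most 1/3 at every lower weight, so `Deg-no-jump`
  -- applies downwards from `N`, with step -1.
  threshold-bound : ∀ b → (∀ w → w ℕ.< N → val w ≡ b) → val N ≡ not b → N ℕ.< run m
  threshold-bound b below top = ℕₚ.≰⇒> λ run≤N →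
    Deg-no-jump m (ι N) (- 1ℚ) (deg (not b)) (∣large∣ N ℕₚ.≤-refl top) λ j 1≤j j≤run →
      let j≤N = ℕₚ.≤-trans j≤run run≤N in
      subst (λ x → ∣ Q (not b) x ∣ ≤ third) (trans (ι-∸ j≤N) (minus (ι N) (ι j)))
        (∣small∣ (N ℕ.∸ j) (ℕₚ.m∸n≤m N j) (below (N ℕ.∸ j) (ℕₚ.∸-monoʳ-< 1≤j j≤N)))
    where
    minus : ∀ x y → x - y ≡ x + - 1ℚ * y
    minus = solve-∀ ℚ-ring

  change : ℕ → Set
  change u = val (suc u) ≡ not (val u)

  -- The component `val u ≡ val s` is what makes the points right after successive changes
  -- alternate.
  scan : ∀ L s → (Σ ℕ λ u → s ℕ.≤ u × suc u ℕ.≤ s ℕ.+ L × val u ≡ val s × change u)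
               ⊎ (∀ j → j ℕ.≤ L → val (s ℕ.+ j) ≡ val s)
  scan zero s = inj₂ λ { .0 z≤n → cong val (ℕₚ.+-identityʳ s) }
  scan (suc L) s with scan L s
  ... | inj₁ (u , s≤u , u<s+L , rest) =
    inj₁ (u , s≤u , ℕₚ.≤-trans u<s+L (ℕₚ.+-monoʳ-≤ s (ℕₚ.n≤1+n L)) , rest)
  ... | inj₂ constant with val (suc (s ℕ.+ L)) Boolₚ.≟ val s
  ...   | no differ = inj₁ (s ℕ.+ L , ℕₚ.m≤m+n s L , ℕₚ.≤-reflexive (sym (ℕₚ.+-suc s L)) , constant L ℕₚ.≤-refl ,
            ≢⇒≡not λ eq → differ (trans eq (constant L ℕₚ.≤-refl)))
  ...   | yes same = inj₂ extend
    where
    extend : ∀ j → j ℕ.≤ suc L → val (s ℕ.+ j) ≡ val s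
    extend j j≤ with ℕₚ.m≤n⇒m<n∨m≡n j≤
    ... | inj₁ (s≤s j≤L) = constant j j≤L
    ... | inj₂ refl      = trans (cong val (ℕₚ.+-suc s L)) same

  -- `Q (not (val (suc t)))` is at least 1 at `t`; were `val` constant from `suc t` on, it would be
  -- at most 1/3 at the next `run m` integers.
  next-change : ∀ t → suc t ℕ.+ run m ℕ.≤ N → change t →
                Σ ℕ λ u → suc t ℕ.≤ u × suc u ℕ.≤ suc t ℕ.+ run m × val u ≡ val (suc t) × change u
  next-change t fits change-t with scan (run m) (suc t)
  ... | inj₁ found = found
  ... | inj₂ constant = ⊥-elim (Deg-no-jump m (ι t) 1ℚ (deg (not (val (suc t))))
          (∣large∣ t (ℕₚ.≤-trans (ℕₚ.n≤1+n t) (ℕₚ.≤-trans (ℕₚ.m≤m+n (suc t) (run m)) fits)) val-t) step)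
    where
    val-t : val t ≡ not (val (suc t))
    val-t = sym (trans (cong not change-t) (Boolₚ.not-involutive (val t)))
    plus : ∀ x y → (1ℚ + x) + y ≡ x + 1ℚ * (1ℚ + y)
    plus = solve-∀ ℚ-ring
    step : ∀ j → 1 ℕ.≤ j → j ℕ.≤ run m → ∣ Q (not (val (suc t))) (ι t + 1ℚ * ι j) ∣ ≤ third
    step (suc j) _ j<run = subst (λ x → ∣ Q (not (val (suc t))) x ∣ ≤ third) (trans (ι-+ (suc t) j) (plus (ι t) (ι j)))
      (∣small∣ (suc t ℕ.+ j) (ℕₚ.≤-trans (ℕₚ.+-monoʳ-≤ (suc t) (ℕₚ.<⇒≤ j<run)) fits) (constant j (ℕₚ.<⇒≤ j<run)))

  alternating-chain : ∀ J u → change u → suc u ℕ.+ J ℕ.* run m ℕ.≤ N →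
    Σ (ℕ → ℕ) λ τ → τ 0 ≡ suc u × (∀ j → τ j ℕ.< τ (suc j)) × (∀ j → j ℕ.≤ J → τ j ℕ.≤ N) ×
                    (∀ j → j ℕ.< J → val (τ (suc j)) ≡ not (val (τ j)))
  alternating-chain zero u _ fits =
    -- Only the value at 0 matters here; going on through consecutive integers keeps the nodes
    -- increasing on all of ℕ, as `Deg-no-alternation` demands.
    (ℕ._+ suc u) , refl , (λ j → ℕₚ.≤-refl) ,
    (λ { .0 z≤n → ℕₚ.≤-trans (ℕₚ.m≤m+n (suc u) 0) fits }) , λ _ ()
  alternating-chain (suc J) u change-u fits
    with next-change u (ℕₚ.≤-trans (ℕₚ.+-monoʳ-≤ (suc u) (ℕₚ.m≤m+n (run m) (J ℕ.* run m))) fits) change-u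
  ... | u′ , u<u′ , u′< , val-u′ , change-u′
    with alternating-chain J u′ change-u′ (ℕₚ.≤-trans (ℕₚ.+-monoˡ-≤ (J ℕ.* run m) u′<)
           (ℕₚ.≤-trans (ℕₚ.≤-reflexive (ℕₚ.+-assoc (suc u) (run m) (J ℕ.* run m))) fits))
  ...   | τ , τ0 , τ-< , τ≤N , τ-alt = τ⁺ , refl , increasing , bounded , alternates
    where
    τ⁺ : ℕ → ℕ
    τ⁺ zero    = suc u
    τ⁺ (suc j) = τ j
    increasing : ∀ j → τ⁺ j ℕ.< τ⁺ (suc j)
    increasing zero    = subst (suc u ℕ.<_) (sym τ0) (s≤s u<u′)
    increasing (suc j) = τ-< j
    bounded : ∀ j → j ℕ.≤ suc J → τ⁺ j ℕ.≤ N
    bounded zero    _         = ℕₚ.≤-trans (ℕₚ.m≤m+n (suc u) (suc J ℕ.* run m)) fits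
    bounded (suc j) (s≤s j≤J) = τ≤N j j≤J
    alternates : ∀ j → j ℕ.< suc J → val (τ⁺ (suc j)) ≡ not (val (τ⁺ j))
    alternates zero    _         = trans (cong val τ0) (trans change-u′ (cong not val-u′))
    alternates (suc j) (s≤s j<J) = τ-alt j j<J

  -- If `N` were larger, the chain would give `m + 2` sign changes of `Q true - Q false`, one more
  -- than its degree. Only the sign counts, so the missing upper bound on large values does no harm.
  symmetric-bound : change 0 → N ℕ.≤ suc (suc m) ℕ.* run m
  symmetric-bound change-0 = ℕₚ.≮⇒≥ λ fits →
    let τ , _ , τ-< , τ≤N , τ-alt = alternating-chain (suc (suc m)) 0 change-0 fits in
    Deg-no-alternation (suc m) dh τ τ-< (λ j → val (τ j))
      (λ j j≤ → h-sign (val (τ j)) (ι (τ j)) (large (τ j) (τ≤N j j≤)) (small (τ j) (τ≤N j j≤)))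
      τ-alt
    where
    h : ℚ → ℚ
    h x = Q true x + - 1ℚ * Q false x
    dh : Deg (suc m) h
    dh = Deg-+ (suc m) (deg true) (Deg-scale (suc m) (- 1ℚ) (deg false))
    separated : ∀ {p q} → 1ℚ ≤ p → q ≤ third → 0ℚ < p - q
    separated 1≤p q≤third = <-≤-trans (positive⁻¹ (1ℚ - third)) (+-mono-≤ 1≤p (neg-antimono-≤ q≤third))
    rearrange₁ : ∀ p q → p - q ≡ p + - 1ℚ * q
    rearrange₁ = solve-∀ ℚ-ring
    rearrange₂ : ∀ p q → q - p ≡ - (p + - 1ℚ * q)
    rearrange₂ = solve-∀ ℚ-ring
    h-sign : ∀ b x → 1ℚ ≤ Q b x → Q (not b) x ≤ third → 0ℚ < signed b (h x)
    h-sign true  x 1≤ ≤third = subst (0ℚ <_) (rearrange₁ (Q true x) (Q false x)) (separated 1≤ ≤third)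
    h-sign false x 1≤ ≤third = subst (0ℚ <_) (rearrange₂ (Q true x) (Q false x)) (separated 1≤ ≤third)

-- Symmetrisation over a subcube

-- A mask prescribes the coordinates marked just; the weight of a point of the subcube counts the free coordinates only.
Mask : ℕ → Set
Mask n = Vec (Maybe Bool) n

free : ∀ {n} → Mask n → ℕ
free []            = 0
free (just _ ∷ μ)  = free μ
free (nothing ∷ μ) = suc (free μ)

data InLevel : ∀ {n} → Mask n → ℕ → Subset n → Set where
  []   : InLevel [] 0 []
  just : ∀ {n} {μ : Mask n} {w z} b → InLevel μ w z → InLevel (just b ∷ μ) w (b ∷ z)
  on   : ∀ {n} {μ : Mask n} {w z} → InLevel μ w z → InLevel (nothing ∷ μ) (suc w) (true ∷ z)
  off  : ∀ {n} {μ : Mask n} {w z} → InLevel μ w z → InLevel (nothing ∷ μ) w (false ∷ z)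

levelSum : ∀ {n} → Mask n → ℕ → (Subset n → ℚ) → ℚ
levelSum []            zero    f = f []
levelSum []            (suc w) f = 0ℚ
levelSum (just b ∷ μ)  w       f = levelSum μ w (λ z → f (b ∷ z))
levelSum (nothing ∷ μ) zero    f = levelSum μ zero (λ z → f (false ∷ z))
levelSum (nothing ∷ μ) (suc w) f = levelSum μ w (λ z → f (true ∷ z)) + levelSum μ (suc w) (λ z → f (false ∷ z))

binom : ℕ → ℕ → ℚ
binom zero    zero    = 1ℚ
binom zero    (suc w) = 0ℚ
binom (suc n) zero    = binom n zero
binom (suc n) (suc w) = binom n w + binom n (suc w)

binom-nonneg : ∀ n w → 0ℚ ≤ binom n w
binom-nonneg zero    zero    = 0≤1
binom-nonneg zero    (suc w) = ≤-refl
binom-nonneg (suc n) zero    = binom-nonneg n zero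
binom-nonneg (suc n) (suc w) = +-mono-≤ (binom-nonneg n w) (binom-nonneg n (suc w))

binom-pos : ∀ {n w} → w ℕ.≤ n → 0ℚ < binom n w
binom-pos {zero}          z≤n       = 0<1
binom-pos {suc n}         z≤n       = binom-pos {n} z≤n
binom-pos {suc n} {suc w} (s≤s w≤n) = +-mono-<-≤ (binom-pos w≤n) (binom-nonneg n (suc w))

binom-absorption : ∀ n w → ι (suc n) * binom n w ≡ ι (suc w) * binom (suc n) (suc w)
binom-absorption zero    zero    = refl
binom-absorption zero    (suc w) = vanish (ι (suc zero)) (ι (suc (suc w)))
  where
  vanish : ∀ x y → x * 0ℚ ≡ y * (0ℚ + 0ℚ)
  vanish = solve-∀ ℚ-ring
binom-absorption (suc n) zero = trans (split (ι (suc n)) (binom n zero))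
  (trans (cong (binom n zero +_) (binom-absorption n zero)) (merge (binom n zero) (binom (suc n) 1)))
  where
  split : ∀ x y → (1ℚ + x) * y ≡ y + x * y
  split = solve-∀ ℚ-ring
  merge : ∀ x y → x + (1ℚ + 0ℚ) * y ≡ (1ℚ + 0ℚ) * (x + y)
  merge = solve-∀ ℚ-ring
binom-absorption (suc n) (suc w) = trans (split (ι (suc n)) (binom n w) (binom n (suc w)))
  (trans (cong₂ (λ p q → (binom n w + binom n (suc w)) + (p + q)) (binom-absorption n w) (binom-absorption n (suc w)))
    (merge (binom (suc n) (suc w)) (binom (suc n) (suc (suc w))) (ι (suc w))))
  where
  split : ∀ x y z → (1ℚ + x) * (y + z) ≡ (y + z) + (x * y + x * z)
  split = solve-∀ ℚ-ring
  merge : ∀ a b x → a + (x * a + (1ℚ + x) * b) ≡ (1ℚ + x) * (a + b)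
  merge = solve-∀ ℚ-ring

levelSum-mono : ∀ {n} (μ : Mask n) w {f g} → (∀ z → InLevel μ w z → f z ≤ g z) → levelSum μ w f ≤ levelSum μ w g
levelSum-mono []            zero    f≤g = f≤g [] []
levelSum-mono []            (suc w) f≤g = ≤-refl
levelSum-mono (just b ∷ μ)  w       f≤g = levelSum-mono μ w λ z z∈ → f≤g (b ∷ z) (just b z∈)
levelSum-mono (nothing ∷ μ) zero    f≤g = levelSum-mono μ zero λ z z∈ → f≤g (false ∷ z) (off z∈)
levelSum-mono (nothing ∷ μ) (suc w) f≤g =
  +-mono-≤ (levelSum-mono μ w λ z z∈ → f≤g (true ∷ z) (on z∈)) (levelSum-mono μ (suc w) λ z z∈ → f≤g (false ∷ z) (off z∈))

levelSum-cong : ∀ {n} (μ : Mask n) w {f g} → (∀ z → f z ≡ g z) → levelSum μ w f ≡ levelSum μ w g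
levelSum-cong []            zero    f≗g = f≗g []
levelSum-cong []            (suc w) f≗g = refl
levelSum-cong (just b ∷ μ)  w       f≗g = levelSum-cong μ w λ z → f≗g (b ∷ z)
levelSum-cong (nothing ∷ μ) zero    f≗g = levelSum-cong μ zero λ z → f≗g (false ∷ z)
levelSum-cong (nothing ∷ μ) (suc w) f≗g =
  cong₂ _+_ (levelSum-cong μ w λ z → f≗g (true ∷ z)) (levelSum-cong μ (suc w) λ z → f≗g (false ∷ z))

levelSum-linear : ∀ {n} (μ : Mask n) w c f g → levelSum μ w (λ z → c * f z + g z) ≡ c * levelSum μ w f + levelSum μ w g
levelSum-linear []            zero    c f g = refl
levelSum-linear []            (suc w) c f g = vanish c
  where
  vanish : ∀ c → 0ℚ ≡ c * 0ℚ + 0ℚ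
  vanish = solve-∀ ℚ-ring
levelSum-linear (just b ∷ μ)  w       c f g = levelSum-linear μ w c (λ z → f (b ∷ z)) (λ z → g (b ∷ z))
levelSum-linear (nothing ∷ μ) zero    c f g = levelSum-linear μ zero c (λ z → f (false ∷ z)) (λ z → g (false ∷ z))
levelSum-linear (nothing ∷ μ) (suc w) c f g =
  trans (cong₂ _+_ (levelSum-linear μ w c (λ z → f (true ∷ z)) (λ z → g (true ∷ z)))
                   (levelSum-linear μ (suc w) c (λ z → f (false ∷ z)) (λ z → g (false ∷ z))))
    (regroup c (levelSum μ w (λ z → f (true ∷ z))) (levelSum μ w (λ z → g (true ∷ z)))
               (levelSum μ (suc w) (λ z → f (false ∷ z))) (levelSum μ (suc w) (λ z → g (false ∷ z))))
  where
  regroup : ∀ c x y u v → (c * x + y) + (c * u + v) ≡ c * (x + u) + (y + v)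
  regroup = solve-∀ ℚ-ring

levelSum-const : ∀ {n} (μ : Mask n) w c → levelSum μ w (λ _ → c) ≡ c * binom (free μ) w
levelSum-const []            zero    c = sym (*-identityʳ c)
levelSum-const []            (suc w) c = sym (*-zeroʳ c)
levelSum-const (just b ∷ μ)  w       c = levelSum-const μ w c
levelSum-const (nothing ∷ μ) zero    c = levelSum-const μ zero c
levelSum-const (nothing ∷ μ) (suc w) c =
  trans (cong₂ _+_ (levelSum-const μ w c) (levelSum-const μ (suc w) c))
    (sym (*-distribˡ-+ c (binom (free μ) w) (binom (free μ) (suc w))))

infix 4 _⊆ᵇ_
_⊆ᵇ_ : ∀ {n} → Subset n → Subset n → Bool
[]          ⊆ᵇ []      = true
(true ∷ u)  ⊆ᵇ (b ∷ z) = b ∧ (u ⊆ᵇ z)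
(false ∷ u) ⊆ᵇ (b ∷ z) = u ⊆ᵇ z

indicator : ∀ {n} → Subset n → Subset n → ℚ
indicator u z = bit (u ⊆ᵇ z)

bit-∧ : ∀ a b → bit (a ∧ b) ≡ bit a * bit b
bit-∧ true  b = sym (*-identityˡ (bit b))
bit-∧ false b = sym (*-zeroˡ (bit b))

∧-⊆ᵇ-∪ : ∀ {n} (u v z : Subset n) → (u ∪ v ⊆ᵇ z) ≡ (u ⊆ᵇ z) ∧ (v ⊆ᵇ z)
∧-⊆ᵇ-∪ []          []          []          = refl
∧-⊆ᵇ-∪ (false ∷ u) (false ∷ v) (b ∷ z)     = ∧-⊆ᵇ-∪ u v z
∧-⊆ᵇ-∪ (true ∷ u)  (false ∷ v) (true ∷ z)  = ∧-⊆ᵇ-∪ u v z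
∧-⊆ᵇ-∪ (true ∷ u)  (false ∷ v) (false ∷ z) = refl
∧-⊆ᵇ-∪ (true ∷ u)  (true ∷ v)  (true ∷ z)  = ∧-⊆ᵇ-∪ u v z
∧-⊆ᵇ-∪ (true ∷ u)  (true ∷ v)  (false ∷ z) = refl
∧-⊆ᵇ-∪ (false ∷ u) (true ∷ v)  (true ∷ z)  = ∧-⊆ᵇ-∪ u v z
∧-⊆ᵇ-∪ (false ∷ u) (true ∷ v)  (false ∷ z) = sym (Boolₚ.∧-zeroʳ (u ⊆ᵇ z))

indicator-∪ : ∀ {n} (u v z : Subset n) → indicator (u ∪ v) z ≡ indicator u z * indicator v z
indicator-∪ u v z = trans (cong bit (∧-⊆ᵇ-∪ u v z)) (bit-∧ (u ⊆ᵇ z) (v ⊆ᵇ z))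

size-∪ : ∀ {n} (u v : Subset n) → size (u ∪ v) ℕ.≤ size u ℕ.+ size v
size-∪ []          []          = z≤n
size-∪ (false ∷ u) (false ∷ v) = size-∪ u v
size-∪ (true ∷ u)  (false ∷ v) = s≤s (size-∪ u v)
size-∪ (false ∷ u) (true ∷ v)  = ℕₚ.≤-trans (s≤s (size-∪ u v)) (ℕₚ.≤-reflexive (sym (ℕₚ.+-suc (size u) (size v))))
size-∪ (true ∷ u)  (true ∷ v)  = s≤s (ℕₚ.≤-trans (size-∪ u v) (ℕₚ.+-monoʳ-≤ (size u) (ℕₚ.n≤1+n (size v))))

-- The binomial coefficient of `M` over `w - s`, zero for `w < s`: the number of `w`-subsets of
-- `s + M` points that contain `s` given points.
shifted-binom : ℕ → ℕ → ℕ → ℚ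
shifted-binom zero    M w       = binom M w
shifted-binom (suc s) M zero    = 0ℚ
shifted-binom (suc s) M (suc w) = shifted-binom s M w

shifted-zero : ∀ s M → shifted-binom s (suc M) 0 ≡ shifted-binom s M 0
shifted-zero zero    M = refl
shifted-zero (suc s) M = refl

shifted-Pascal : ∀ s M w → shifted-binom s (suc M) (suc w) ≡ shifted-binom s M w + shifted-binom s M (suc w)
shifted-Pascal zero    M w       = refl
shifted-Pascal (suc s) M zero    = trans (shifted-zero s M) (sym (+-identityˡ (shifted-binom s M 0)))
shifted-Pascal (suc s) M (suc w) = shifted-Pascal s M w

falling : ℕ → ℚ → ℚ
falling zero    x = 1ℚ
falling (suc s) x = x * falling s (x - 1ℚ)

ι-pred : ∀ n → ι (suc n) - 1ℚ ≡ ι n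
ι-pred n = cancel (ι n)
  where
  cancel : ∀ x → (1ℚ + x) - 1ℚ ≡ x
  cancel = solve-∀ ℚ-ring

falling-pos : ∀ s M → 0ℚ < falling s (ι (s ℕ.+ M))
falling-pos zero    M = 0<1
falling-pos (suc s) M = *-pos (ι-pos (s ℕ.+ M)) (subst (λ x → 0ℚ < falling s x) (sym (ι-pred (s ℕ.+ M))) (falling-pos s M))

Deg-falling : ∀ s → Deg s (falling s)
Deg-falling zero    = Deg-const 0 1ℚ
Deg-falling (suc s) = Deg-var* s (Deg-resp s (λ x → cong (falling s) (shift x)) (Deg-∘affine s (- 1ℚ) 1ℚ (Deg-falling s)))
  where
  shift : ∀ x → - 1ℚ + 1ℚ * x ≡ x - 1ℚ
  shift = solve-∀ ℚ-ring

-- The core of the symmetrisation: the fraction of `w`-subsets that contain `s` given points is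
-- `falling s` at `w` over its value at `s + M`, a polynomial of degree `s` in `w`. Each step is one
-- use of `binom-absorption`.
shifted-falling : ∀ s M w → falling s (ι (s ℕ.+ M)) * shifted-binom s M w ≡ falling s (ι w) * binom (s ℕ.+ M) w
shifted-falling zero    M w    = refl
shifted-falling (suc s) M zero = vanish (falling (suc s) (ι (suc s ℕ.+ M))) (falling s (0ℚ - 1ℚ)) (binom (suc s ℕ.+ M) 0)
  where
  vanish : ∀ x y z → x * 0ℚ ≡ (0ℚ * y) * z
  vanish = solve-∀ ℚ-ring
shifted-falling (suc s) M (suc w) = begin
  (ι (suc N) * falling s (ι (suc N) - 1ℚ)) * shifted-binom s M w
    ≡⟨ cong (λ x → (ι (suc N) * falling s x) * shifted-binom s M w) (ι-pred N) ⟩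
  (ι (suc N) * falling s (ι N)) * shifted-binom s M w
    ≡⟨ *-assoc (ι (suc N)) (falling s (ι N)) (shifted-binom s M w) ⟩
  ι (suc N) * (falling s (ι N) * shifted-binom s M w)
    ≡⟨ cong (ι (suc N) *_) (shifted-falling s M w) ⟩
  ι (suc N) * (falling s (ι w) * binom N w)
    ≡⟨ swap (ι (suc N)) (falling s (ι w)) (binom N w) ⟩
  falling s (ι w) * (ι (suc N) * binom N w)
    ≡⟨ cong (falling s (ι w) *_) (binom-absorption N w) ⟩
  falling s (ι w) * (ι (suc w) * binom (suc N) (suc w))
    ≡⟨ regroup (falling s (ι w)) (ι (suc w)) (binom (suc N) (suc w)) ⟩
  (ι (suc w) * falling s (ι w)) * binom (suc N) (suc w)
    ≡⟨ cong (λ x → (ι (suc w) * falling s x) * binom (suc N) (suc w)) (sym (ι-pred w)) ⟩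
  (ι (suc w) * falling s (ι (suc w) - 1ℚ)) * binom (suc N) (suc w) ∎
  where
  open ≡-Reasoning
  N = s ℕ.+ M
  swap : ∀ x y z → x * (y * z) ≡ y * (x * z)
  swap = solve-∀ ℚ-ring
  regroup : ∀ x y z → x * (y * z) ≡ (y * x) * z
  regroup = solve-∀ ℚ-ring

-- The first alternative covers subsets u that contain a coordinate which μ prescribes to be false.
levelSum-indicator : ∀ {n} (μ : Mask n) (u : Subset n) →
  (∀ w → levelSum μ w (indicator u) ≡ 0ℚ) ⊎
  (∃₂ λ s M → s ℕ.+ M ≡ free μ × s ℕ.≤ size u × (∀ w → levelSum μ w (indicator u) ≡ shifted-binom s M w))
levelSum-indicator [] [] = inj₂ (0 , 0 , refl , z≤n , λ { zero → refl ; (suc w) → refl })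
levelSum-indicator (just b ∷ μ) (false ∷ u) = levelSum-indicator μ u
levelSum-indicator (just true ∷ μ) (true ∷ u) with levelSum-indicator μ u
... | inj₁ zero-sum = inj₁ zero-sum
... | inj₂ (s , M , s+M , s≤ , sum) = inj₂ (s , M , s+M , ℕₚ.m≤n⇒m≤1+n s≤ , sum)
levelSum-indicator (just false ∷ μ) (true ∷ u) = inj₁ λ w → trans (levelSum-const μ w 0ℚ) (*-zeroˡ (binom (free μ) w))
levelSum-indicator (nothing ∷ μ) (true ∷ u) with levelSum-indicator μ u
... | inj₁ zero-sum = inj₁ λ
  { zero    → trans (levelSum-const μ 0 0ℚ) (*-zeroˡ (binom (free μ) 0))
  ; (suc w) → cong₂ _+_ (zero-sum w) (trans (levelSum-const μ (suc w) 0ℚ) (*-zeroˡ (binom (free μ) (suc w)))) }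
... | inj₂ (s , M , s+M , s≤ , sum) = inj₂ (suc s , M , cong suc s+M , s≤s s≤ , λ
  { zero    → trans (levelSum-const μ 0 0ℚ) (*-zeroˡ (binom (free μ) 0))
  ; (suc w) → trans (cong₂ _+_ (sum w) (trans (levelSum-const μ (suc w) 0ℚ) (*-zeroˡ (binom (free μ) (suc w)))))
                (+-identityʳ (shifted-binom s M w)) })
levelSum-indicator (nothing ∷ μ) (false ∷ u) with levelSum-indicator μ u
... | inj₁ zero-sum = inj₁ λ { zero → zero-sum zero ; (suc w) → cong₂ _+_ (zero-sum w) (zero-sum (suc w)) }
... | inj₂ (s , M , s+M , s≤ , sum) = inj₂ (s , suc M , trans (ℕₚ.+-suc s M) (cong suc s+M) , s≤ , λ
  { zero    → trans (sum zero) (sym (shifted-zero s M))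
  ; (suc w) → trans (cong₂ _+_ (sum w) (sum (suc w))) (sym (shifted-Pascal s M w)) })

-- Cleared of denominators, so that it also makes sense for `w` above `free μ`, where both sides
-- vanish.
IsLevelAverage : ∀ {n} → Mask n → (Subset n → ℚ) → (ℚ → ℚ) → Set
IsLevelAverage μ f Q = ∀ w → Q (ι w) * binom (free μ) w ≡ levelSum μ w f

indicator-average : ∀ {n} (μ : Mask n) (u : Subset n) {s} → size u ℕ.≤ s →
                    Σ (ℚ → ℚ) λ Q → Deg s Q × IsLevelAverage μ (indicator u) Q
indicator-average μ u {s} u≤s with levelSum-indicator μ u
... | inj₁ zero-sum = (λ _ → 0ℚ) , Deg-const s 0ℚ , λ w → trans (*-zeroˡ (binom (free μ) w)) (sym (zero-sum w))
... | inj₂ (t , M , t+M , t≤u , sum) with reciprocal _ (falling-pos t M)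
...   | κ , _ , κ-inverse =
  (λ x → κ * falling t x) , Deg-mono (ℕₚ.≤-trans t≤u u≤s) (Deg-scale t κ (Deg-falling t)) , λ w → begin
    (κ * falling t (ι w)) * binom (free μ) w
      ≡⟨ cong (λ N → (κ * falling t (ι w)) * binom N w) (sym t+M) ⟩
    (κ * falling t (ι w)) * binom (t ℕ.+ M) w
      ≡⟨ *-assoc κ (falling t (ι w)) (binom (t ℕ.+ M) w) ⟩
    κ * (falling t (ι w) * binom (t ℕ.+ M) w)
      ≡⟨ cong (κ *_) (sym (shifted-falling t M w)) ⟩
    κ * (falling t (ι (t ℕ.+ M)) * shifted-binom t M w)
      ≡⟨ sym (*-assoc κ (falling t (ι (t ℕ.+ M))) (shifted-binom t M w)) ⟩
    (κ * falling t (ι (t ℕ.+ M))) * shifted-binom t M w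
      ≡⟨ trans (cong (_* shifted-binom t M w) κ-inverse) (*-identityˡ (shifted-binom t M w)) ⟩
    shifted-binom t M w
      ≡⟨ sym (sum w) ⟩
    levelSum μ w (indicator u) ∎
  where open ≡-Reasoning

-- Multilinear polynomials of degree at most s in the indicator variables of the vertices.
data Span {n : ℕ} (s : ℕ) : (Subset n → ℚ) → Set where
  empty : ∀ {f} → (∀ z → f z ≡ 0ℚ) → Span s f
  add   : ∀ {f g} c u → size u ℕ.≤ s → Span s g → (∀ z → f z ≡ c * indicator u z + g z) → Span s f

Span-average : ∀ {n s f} (μ : Mask n) → Span s f → Σ (ℚ → ℚ) λ Q → Deg s Q × IsLevelAverage μ f Q
Span-average {s = s} μ (empty f≗0) = (λ _ → 0ℚ) , Deg-const s 0ℚ , λ w →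
  sym (trans (levelSum-cong μ w f≗0) (levelSum-const μ w 0ℚ))
Span-average {s = s} {f = f} μ (add {g = g} c u u≤s span-g f≗) with indicator-average μ u u≤s | Span-average μ span-g
... | A , dA , avg-A | B , dB , avg-B = (λ x → c * A x + B x) , Deg-+ s (Deg-scale s c dA) dB , λ w → begin
    (c * A (ι w) + B (ι w)) * binom (free μ) w
      ≡⟨ expand c (A (ι w)) (B (ι w)) (binom (free μ) w) ⟩
    c * (A (ι w) * binom (free μ) w) + B (ι w) * binom (free μ) w
      ≡⟨ cong₂ (λ p q → c * p + q) (avg-A w) (avg-B w) ⟩
    c * levelSum μ w (indicator u) + levelSum μ w g
      ≡⟨ sym (levelSum-linear μ w c (indicator u) g) ⟩
    levelSum μ w (λ z → c * indicator u z + g z)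
      ≡⟨ sym (levelSum-cong μ w f≗) ⟩
    levelSum μ w f ∎
  where
  open ≡-Reasoning
  expand : ∀ c a b x → (c * a + b) * x ≡ c * (a * x) + b * x
  expand = solve-∀ ℚ-ring

Span-+ : ∀ {n s} {f g h : Subset n → ℚ} → Span s f → Span s g → (∀ z → h z ≡ f z + g z) → Span s h
Span-+ {g = g} (empty f≗0) (empty g≗0) h≗ = empty λ z → trans (h≗ z) (cong₂ _+_ (f≗0 z) (g≗0 z))
Span-+ {g = g} (empty f≗0) (add c u u≤s span-r g≗) h≗ =
  add c u u≤s span-r λ z → trans (h≗ z) (trans (cong₂ _+_ (f≗0 z) (g≗ z)) (+-identityˡ _))
Span-+ {g = g} (add {g = r} c u u≤s span-r f≗) span-g h≗ =
  add c u u≤s (Span-+ span-r span-g (λ _ → refl)) λ z →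
    trans (h≗ z) (trans (cong (_+ g z) (f≗ z)) (+-assoc (c * indicator u z) (r z) (g z)))

Span-indicator* : ∀ {n s t} {f h : Subset n → ℚ} c u → size u ℕ.≤ s → Span t f →
                  (∀ z → h z ≡ c * indicator u z * f z) → Span (s ℕ.+ t) h
Span-indicator* c u u≤s (empty f≗0) h≗ =
  empty λ z → trans (h≗ z) (trans (cong (c * indicator u z *_) (f≗0 z)) (*-zeroʳ (c * indicator u z)))
Span-indicator* c u u≤s (add {g = g} d v v≤t span-g f≗) h≗ =
  add (c * d) (u ∪ v) (ℕₚ.≤-trans (size-∪ u v) (ℕₚ.+-mono-≤ u≤s v≤t)) (Span-indicator* c u u≤s span-g (λ _ → refl)) λ z →
    trans (h≗ z) (trans (cong (c * indicator u z *_) (f≗ z))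
      (trans (expand c (indicator u z) d (indicator v z) (g z))
        (cong (λ y → c * d * y + c * indicator u z * g z) (sym (indicator-∪ u v z)))))
  where
  expand : ∀ c x d y r → c * x * (d * y + r) ≡ c * d * (x * y) + c * x * r
  expand = solve-∀ ℚ-ring

Span-* : ∀ {n s t} {f g h : Subset n → ℚ} → Span s f → Span t g → (∀ z → h z ≡ f z * g z) → Span (s ℕ.+ t) h
Span-* {g = g} (empty f≗0) span-g h≗ = empty λ z → trans (h≗ z) (trans (cong (_* g z) (f≗0 z)) (*-zeroˡ (g z)))
Span-* {g = g} (add {g = r} c u u≤s span-r f≗) span-g h≗ =
  Span-+ (Span-indicator* c u u≤s span-g (λ _ → refl)) (Span-* span-r span-g (λ _ → refl)) λ z →
    trans (h≗ z) (trans (cong (_* g z) (f≗ z)) (*-distribʳ-+ (g z) (c * indicator u z) (r z)))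

square : ∀ x → ∣ x ∣ * ∣ x ∣ ≡ x * x
square x with ∣p∣≡p∨∣p∣≡-p x
... | inj₁ eq rewrite eq = refl
... | inj₂ eq rewrite eq = neg-square x
  where
  neg-square : ∀ x → - x * - x ≡ x * x
  neg-square = solve-∀ ℚ-ring

square-nonneg : ∀ x → 0ℚ ≤ x * x
square-nonneg x = subst (0ℚ ≤_) (square x) (*-nonneg (0≤∣p∣ x) (0≤∣p∣ x))

square-large : ∀ x → 1ℚ ≤ ∣ x ∣ → 1ℚ ≤ x * x
square-large x 1≤ = ≤-trans 1≤ (subst₂ _≤_ (*-identityʳ (∣ x ∣)) (square x) (*-monoˡ-≤ (0≤∣p∣ x) 1≤))

square-small : ∀ x → ∣ x ∣ ≤ third → x * x ≤ third
square-small x ≤third =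
  subst₂ _≤_ (square x) (*-identityʳ third)
    (≤-trans (*-monoˡ-≤ (0≤∣p∣ x) (≤-trans ≤third (<⇒≤ third<1)))
      (subst₂ _≤_ (sym (*-identityʳ (∣ x ∣))) (sym (*-identityʳ third)) ≤third))

-- The sign of `f c` may vary within a level, so its average could cancel. Squares are nonnegative
-- and stay at least 1 or at most 1/3, bounds that averaging preserves; the price is a doubled
-- degree.
symmetrise : ∀ {n m s} (μ : Mask n) (g : Subset n → Bool) (val : ℕ → Bool) →
  (∀ w z → InLevel μ w z → g z ≡ val w) → s ℕ.+ s ℕ.≤ suc m →
  (f : Bool → Subset n → ℚ) → (∀ c → Span s (f c)) →
  (∀ z → 1ℚ ≤ ∣ f (g z) z ∣) → (∀ z → ∣ f (not (g z)) z ∣ ≤ third) →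
  Σ (Bool → ℚ → ℚ) (Separates m (free μ) val)
symmetrise {n} {m} {s} μ g val levels 2s≤ f span f-large f-small = Q , record
  { deg   = λ c → Deg-mono 2s≤ (proj₁ (proj₂ (average c)))
  ; large = λ w w≤N → lower w≤N (val w) 1ℚ λ z z∈ →
      square-large (f (val w) z) (subst (λ b → 1ℚ ≤ ∣ f b z ∣) (levels w z z∈) (f-large z))
  ; pos   = λ w w≤N → lower w≤N (not (val w)) 0ℚ λ z _ → square-nonneg (f (not (val w)) z)
  ; small = λ w w≤N → upper w≤N (not (val w)) third λ z z∈ →
      square-small (f (not (val w)) z) (subst (λ b → ∣ f (not b) z ∣ ≤ third) (levels w z z∈) (f-small z))
  }
  where
  f² : Bool → Subset n → ℚ
  f² c z = f c z * f c z
  average : ∀ c → Σ (ℚ → ℚ) λ Q → Deg (s ℕ.+ s) Q × IsLevelAverage μ (f² c) Q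
  average c = Span-average μ (Span-* (span c) (span c) (λ _ → refl))
  Q : Bool → ℚ → ℚ
  Q c = proj₁ (average c)
  commuted : ∀ c w → binom (free μ) w * Q c (ι w) ≡ levelSum μ w (f² c)
  commuted c w = trans (*-comm (binom (free μ) w) (Q c (ι w))) (proj₂ (proj₂ (average c)) w)
  constant : ∀ a w → levelSum μ w (λ _ → a) ≡ binom (free μ) w * a
  constant a w = trans (levelSum-const μ w a) (*-comm a (binom (free μ) w))
  lower : ∀ {w} → w ℕ.≤ free μ → ∀ c a → (∀ z → InLevel μ w z → a ≤ f² c z) → a ≤ Q c (ι w)
  lower {w} w≤N c a bound =
    *-cancelˡ-≤ (binom-pos w≤N) (subst₂ _≤_ (constant a w) (sym (commuted c w)) (levelSum-mono μ w bound))
  upper : ∀ {w} → w ℕ.≤ free μ → ∀ c a → (∀ z → InLevel μ w z → f² c z ≤ a) → Q c (ι w) ≤ a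
  upper {w} w≤N c a bound =
    *-cancelˡ-≤ (binom-pos w≤N) (subst₂ _≤_ (sym (commuted c w)) (constant a w) (levelSum-mono μ w bound))

-- Twins and symmetric families of hypergraphs

InLevel⇒≤free : ∀ {n} {μ : Mask n} {w z} → InLevel μ w z → w ℕ.≤ free μ
InLevel⇒≤free []          = z≤n
InLevel⇒≤free (just b z∈) = InLevel⇒≤free z∈
InLevel⇒≤free (on z∈)     = s≤s (InLevel⇒≤free z∈)
InLevel⇒≤free (off z∈)    = ℕₚ.m≤n⇒m≤1+n (InLevel⇒≤free z∈)

representative : ∀ {n} → Mask n → ℕ → Subset n
representative []            w       = []
representative (just b ∷ μ)  w       = b ∷ representative μ w
representative (nothing ∷ μ) zero    = false ∷ representative μ zero
representative (nothing ∷ μ) (suc w) = true ∷ representative μ w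

representative∈ : ∀ {n} (μ : Mask n) {w} → w ℕ.≤ free μ → InLevel μ w (representative μ w)
representative∈ []                    z≤n       = []
representative∈ (just b ∷ μ)          w≤        = just b (representative∈ μ w≤)
representative∈ (nothing ∷ μ) {zero}  _         = off (representative∈ μ z≤n)
representative∈ (nothing ∷ μ) {suc w} (s≤s w≤)  = on (representative∈ μ w≤)

image-≡ : ∀ {n} (σ : Permutation′ n) (z z′ : Subset n) → (∀ i → lookup z (σ ⟨$⟩ˡ i) ≡ lookup z′ i) → image σ z ≡ z′
image-≡ σ z z′ eq = trans (tabulate-cong eq) (tabulate∘lookup z′)

lookup-image : ∀ {n} (σ : Permutation′ n) (z : Subset n) i → lookup (image σ z) i ≡ lookup z (σ ⟨$⟩ˡ i)
lookup-image σ z i = lookup∘tabulate (λ j → lookup z (σ ⟨$⟩ˡ j)) i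

lookup-ext : ∀ {n} {z z′ : Subset n} → (∀ i → lookup z i ≡ lookup z′ i) → z ≡ z′
lookup-ext {z = z} {z′} eq = trans (sym (tabulate∘lookup z)) (trans (tabulate-cong eq) (tabulate∘lookup z′))

record Moves {n : ℕ} (μ : Mask n) (z z′ : Subset n) : Set where
  constructor moves
  field
    perm     : Permutation′ n
    image-of : image perm z ≡ z′
    fixes    : ∀ i b → lookup μ i ≡ just b → perm ⟨$⟩ˡ i ≡ i

Moves-refl : ∀ {n} {μ : Mask n} {z} → Moves μ z z
Moves-refl {z = z} = moves Perm.id (tabulate∘lookup z) λ _ _ _ → refl

Moves-sym : ∀ {n} {μ : Mask n} {z z′} → Moves μ z z′ → Moves μ z′ z
Moves-sym {z = z} {z′} (moves σ refl fixes) = moves (Perm.flip σ)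
  (image-≡ (Perm.flip σ) z′ z λ i → trans (lookup-image σ z (σ ⟨$⟩ʳ i)) (cong (lookup z) (Perm.inverseˡ σ)))
  λ i b μi → trans (cong (σ ⟨$⟩ʳ_) (sym (fixes i b μi))) (Perm.inverseʳ σ)

Moves-trans : ∀ {n} {μ : Mask n} {z z′ z″} → Moves μ z z′ → Moves μ z′ z″ → Moves μ z z″
Moves-trans {z = z} (moves σ refl fixes-σ) (moves τ refl fixes-τ) = moves (σ ∘ₚ τ)
  (tabulate-cong λ i → sym (lookup-image σ z (τ ⟨$⟩ˡ i)))
  λ i b μi → trans (cong (σ ⟨$⟩ˡ_) (fixes-τ i b μi)) (fixes-σ i b μi)

Moves-∷ : ∀ {n} {μ : Mask n} {z z′} a b → Moves μ z z′ → Moves (a ∷ μ) (b ∷ z) (b ∷ z′)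
Moves-∷ a b (moves σ refl fixes) = moves (lift₀ σ) refl λ { zero c _ → refl ; (suc i) c μi → cong suc (fixes i c μi) }

just≢nothing : ∀ {A B : Set} {x : A} {m : Maybe A} → m ≡ just x → m ≡ nothing → B
just≢nothing refl ()

Moves-transpose : ∀ {n} {μ : Mask n} {z} j → lookup μ j ≡ nothing → lookup z j ≡ true →
                  Moves (nothing ∷ μ) (true ∷ (z [ j ]≔ false)) (false ∷ z)
Moves-transpose {μ = μ} {z} j free-j z-j = moves (Perm.transpose zero (suc j))
  (image-≡ (Perm.transpose zero (suc j)) (true ∷ (z [ j ]≔ false)) (false ∷ z) moved) fixes
  where
  moved : ∀ i → lookup (true ∷ (z [ j ]≔ false)) (Perm.transpose zero (suc j) ⟨$⟩ˡ i) ≡ lookup (false ∷ z) i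
  moved zero = lookup∘update j z false
  moved (suc i) with i Finₚ.≟ j
  ... | yes refl = sym z-j
  ... | no i≢j   = lookup∘update′ i≢j z false
  fixes : ∀ i b → lookup (nothing ∷ μ) i ≡ just b → Perm.transpose zero (suc j) ⟨$⟩ˡ i ≡ i
  fixes (suc i) b μi with i Finₚ.≟ j
  ... | yes refl = just≢nothing μi free-j
  ... | no _     = refl

remove-one : ∀ {n} {μ : Mask n} {w z} → InLevel μ (suc w) z →
             Σ (Fin n) λ j → lookup μ j ≡ nothing × lookup z j ≡ true × InLevel μ w (z [ j ]≔ false)
remove-one (just b z∈) with remove-one z∈
... | j , free-j , z-j , z′∈ = suc j , free-j , z-j , just b z′∈
remove-one (on z∈) = zero , refl , refl , off z∈
remove-one (off z∈) with remove-one z∈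
... | j , free-j , z-j , z′∈ = suc j , free-j , z-j , off z′∈

-- Permutations of the free coordinates act transitively on a level. If the first entries differ,
-- the set without the first point has another free point, and transposing the two reduces to equal
-- first entries.
InLevel⇒Moves : ∀ {n} (μ : Mask n) {w z z′} → InLevel μ w z → InLevel μ w z′ → Moves μ z z′
InLevel⇒Moves []            []          []           = Moves-refl
InLevel⇒Moves (just b ∷ μ)  (just _ z∈) (just _ z′∈) = Moves-∷ (just b) b (InLevel⇒Moves μ z∈ z′∈)
InLevel⇒Moves (nothing ∷ μ) (on z∈)     (on z′∈)     = Moves-∷ nothing true (InLevel⇒Moves μ z∈ z′∈)
InLevel⇒Moves (nothing ∷ μ) (off z∈)    (off z′∈)    = Moves-∷ nothing false (InLevel⇒Moves μ z∈ z′∈)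
InLevel⇒Moves (nothing ∷ μ) (on z∈)     (off z′∈) with remove-one z′∈
... | j , free-j , z′-j , y∈ =
  Moves-trans (Moves-∷ nothing true (InLevel⇒Moves μ z∈ y∈)) (Moves-transpose j free-j z′-j)
InLevel⇒Moves (nothing ∷ μ) (off z∈)    (on z′∈) with remove-one z∈
... | j , free-j , z-j , y∈ =
  Moves-trans (Moves-sym (Moves-transpose j free-j z-j)) (Moves-∷ nothing true (InLevel⇒Moves μ y∈ z′∈))

⊆ᵇ-sound : ∀ {n} (u z : Subset n) → (u ⊆ᵇ z) ≡ true → ∀ i → lookup u i ≡ true → lookup z i ≡ true
⊆ᵇ-sound (true ∷ u)  (true ∷ z) u⊆z zero    _  = refl
⊆ᵇ-sound (true ∷ u)  (true ∷ z) u⊆z (suc i) ui = ⊆ᵇ-sound u z u⊆z i ui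
⊆ᵇ-sound (false ∷ u) (_ ∷ z)    u⊆z (suc i) ui = ⊆ᵇ-sound u z u⊆z i ui

⊆ᵇ-complete : ∀ {n} (u z : Subset n) → (∀ i → lookup u i ≡ true → lookup z i ≡ true) → (u ⊆ᵇ z) ≡ true
⊆ᵇ-complete []          []      _   = refl
⊆ᵇ-complete (true ∷ u)  (b ∷ z) u⊆z rewrite u⊆z zero refl = ⊆ᵇ-complete u z λ i → u⊆z (suc i)
⊆ᵇ-complete (false ∷ u) (b ∷ z) u⊆z = ⊆ᵇ-complete u z λ i → u⊆z (suc i)

⊆ᵇ⇒size≤ : ∀ {n} (u z : Subset n) → (u ⊆ᵇ z) ≡ true → size u ℕ.≤ size z
⊆ᵇ⇒size≤ []          []          _   = z≤n
⊆ᵇ⇒size≤ (true ∷ u)  (true ∷ z)  u⊆z = s≤s (⊆ᵇ⇒size≤ u z u⊆z)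
⊆ᵇ⇒size≤ (false ∷ u) (true ∷ z)  u⊆z = ℕₚ.m≤n⇒m≤1+n (⊆ᵇ⇒size≤ u z u⊆z)
⊆ᵇ⇒size≤ (false ∷ u) (false ∷ z) u⊆z = ⊆ᵇ⇒size≤ u z u⊆z

Bool-ext : ∀ {a b} → (a ≡ true → b ≡ true) → (b ≡ true → a ≡ true) → a ≡ b
Bool-ext {true}  f g = sym (f refl)
Bool-ext {false} {true}  f g = g refl
Bool-ext {false} {false} f g = refl

image-⊆ᵇ : ∀ {n} (σ : Permutation′ n) (u z : Subset n) → (image σ u ⊆ᵇ image σ z) ≡ (u ⊆ᵇ z)
image-⊆ᵇ σ u z = Bool-ext
  (λ ⊆ → ⊆ᵇ-complete u z λ i ui → trans (sym (at z i)) (⊆ᵇ-sound (image σ u) (image σ z) ⊆ (σ ⟨$⟩ʳ i) (trans (at u i) ui)))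
  (λ ⊆ → ⊆ᵇ-complete (image σ u) (image σ z) λ i ui →
    trans (lookup-image σ z i) (⊆ᵇ-sound u z ⊆ (σ ⟨$⟩ˡ i) (trans (sym (lookup-image σ u i)) ui)))
  where
  at : ∀ y i → lookup (image σ y) (σ ⟨$⟩ʳ i) ≡ lookup y i
  at y i = trans (lookup-image σ y (σ ⟨$⟩ʳ i)) (cong (lookup y) (Perm.inverseˡ σ))

size-remove : ∀ {n} (u : Subset n) v → lookup u v ≡ true → size u ≡ suc (size (u [ v ]≔ false))
size-remove (true ∷ u)  zero    _  = refl
size-remove (true ∷ u)  (suc v) uv = cong suc (size-remove u v uv)
size-remove (false ∷ u) (suc v) uv = size-remove u v uv

member? : ∀ {n} (u : Subset n) → (Σ (Fin n) λ v → lookup u v ≡ true) ⊎ (size u ≡ 0)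
member? []          = inj₂ refl
member? (true ∷ u)  = inj₁ (zero , refl)
member? (false ∷ u) with member? u
... | inj₁ (v , uv) = inj₁ (suc v , uv)
... | inj₂ empty-u  = inj₂ empty-u

below : ∀ {n} → Subset n → Mask n
below = map (λ b → if b then nothing else just false)

above : ∀ {n} → Subset n → Mask n
above = map (λ b → if b then just true else nothing)

free-below : ∀ {n} (u : Subset n) → free (below u) ≡ size u
free-below []          = refl
free-below (true ∷ u)  = cong suc (free-below u)
free-below (false ∷ u) = free-below u

free-above : ∀ {n} (u : Subset n) → free (above u) ℕ.+ size u ≡ n
free-above []          = refl
free-above (true ∷ u)  = trans (ℕₚ.+-suc (free (above u)) (size u)) (cong suc (free-above u))
free-above (false ∷ u) = cong suc (free-above u)

InLevel-below-size : ∀ {n} (u : Subset n) {w z} → InLevel (below u) w z → size z ≡ w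
InLevel-below-size []          []                = refl
InLevel-below-size (true ∷ u)  (on z∈)           = cong suc (InLevel-below-size u z∈)
InLevel-below-size (true ∷ u)  (off z∈)          = InLevel-below-size u z∈
InLevel-below-size (false ∷ u) (just .false z∈)  = InLevel-below-size u z∈

InLevel-below-top : ∀ {n} (u : Subset n) {z} → InLevel (below u) (size u) z → z ≡ u
InLevel-below-top []          []               = refl
InLevel-below-top (true ∷ u)  (on z∈)          = cong (true ∷_) (InLevel-below-top u z∈)
InLevel-below-top (true ∷ u)  (off z∈)         =
  ⊥-elim (ℕₚ.<-irrefl refl (ℕₚ.≤-trans (InLevel⇒≤free z∈) (ℕₚ.≤-reflexive (free-below u))))
InLevel-below-top (false ∷ u) (just .false z∈) = cong (false ∷_) (InLevel-below-top u z∈)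

InLevel-above-bottom : ∀ {n} (u : Subset n) → InLevel (above u) 0 u
InLevel-above-bottom []          = []
InLevel-above-bottom (true ∷ u)  = just true (InLevel-above-bottom u)
InLevel-above-bottom (false ∷ u) = off (InLevel-above-bottom u)

InLevel-above-one : ∀ {n} (u : Subset n) v → lookup u v ≡ true → InLevel (above (u [ v ]≔ false)) 1 u
InLevel-above-one (true ∷ u)  zero    _  = on (InLevel-above-bottom u)
InLevel-above-one (true ∷ u)  (suc v) uv = just true (InLevel-above-one u v uv)
InLevel-above-one (false ∷ u) (suc v) uv = off (InLevel-above-one u v uv)

above-fixed : ∀ {n} (u : Subset n) i → lookup u i ≡ true → lookup (above u) i ≡ just true
above-fixed u i ui = trans (lookup-map i (λ b → if b then just true else nothing) u) (cong (λ b → if b then just true else nothing) ui)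

-- Induced subhypergraphs and blow-ups

induced : ∀ {n k} → Hypergraph n k → Subset n → Hypergraph n k
induced H z e = H e ∧ (proj₁ e ⊆ᵇ z)

indicator-∅ : ∀ {n} (z : Subset n) → (∅ ⊆ᵇ z) ≡ true
indicator-∅ []      = refl
indicator-∅ (_ ∷ z) = indicator-∅ z

-- As `H` is fixed, the variable `e` becomes the constant `bit (H e)` times the indicator of
-- `e ⊆ z`, and a product of such indicators is the indicator of the union of the edges.
evalMono-induced : ∀ {n k} (H : Hypergraph n k) (m : List (KSet n k)) →
  ∃₂ λ c u → size u ℕ.≤ k ℕ.* length m × (∀ z → evalMono (induced H z) m ≡ c * indicator u z)
evalMono-induced {n} {k} H [] = 1ℚ , ∅ , ℕₚ.≤-trans (ℕₚ.≤-reflexive (∣⊥∣≡0 n)) z≤n , λ z →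
  sym (trans (*-identityˡ (indicator ∅ z)) (cong bit (indicator-∅ z)))
evalMono-induced {n} {k} H (e ∷ m) with evalMono-induced H m
... | c , u , u≤ , eq = bit (H e) * c , proj₁ e ∪ u ,
  ℕₚ.≤-trans (size-∪ (proj₁ e) u)
    (ℕₚ.≤-trans (ℕₚ.+-mono-≤ (ℕₚ.≤-reflexive (proj₂ e)) u≤) (ℕₚ.≤-reflexive (sym (ℕₚ.*-suc k (length m))))) ,
  λ z → trans (cong₂ _*_ (bit-∧ (H e) (proj₁ e ⊆ᵇ z)) (eq z))
    (trans (regroup (bit (H e)) (indicator (proj₁ e) z) c (indicator u z))
      (cong (bit (H e) * c *_) (sym (indicator-∪ (proj₁ e) u z))))
  where
  regroup : ∀ h x c y → h * x * (c * y) ≡ h * c * (x * y)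
  regroup = solve-∀ ℚ-ring

eval-induced : ∀ {n k d} (H : Hypergraph n k) (p : Poly (KSet n k)) → degree p ℕ.≤ d →
               Span (k ℕ.* d) (λ z → eval p (induced H z))
eval-induced H [] _ = empty λ _ → refl
eval-induced {k = k} H ((c , m) ∷ p) deg≤ with evalMono-induced H m
... | c′ , u , u≤ , eq =
  add (c * c′) u (ℕₚ.≤-trans u≤ (ℕₚ.*-monoʳ-≤ k (ℕₚ.≤-trans (ℕₚ.m≤m⊔n (length m) (degree p)) deg≤)))
    (eval-induced H p (ℕₚ.≤-trans (ℕₚ.m≤n⊔m (length m) (degree p)) deg≤)) λ z →
    cong (_+ eval p (induced H z)) (trans (cong (c *_) (eq z)) (sym (*-assoc c c′ (indicator u z))))

KSet-≡ : ∀ {n k} {e e′ : KSet n k} → proj₁ e ≡ proj₁ e′ → e ≡ e′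
KSet-≡ {e = s , p} {.s , q} refl = cong (s ,_) (ℕₚ.≡-irrelevant p q)

-- The identity permutation relates pointwise equal hypergraphs, so invariance takes the place of
-- function extensionality.
property-cong : ∀ {n k} {P : Hypergraph n k → Bool} → IsHypergraphProperty P →
                ∀ {H H′} → (∀ e → H e ≡ H′ e) → P H ≡ P H′
property-cong isP {H} {H′} H≗H′ = isP H H′ Perm.id λ e e′ e′≡ →
  trans (H≗H′ e) (cong H′ (KSet-≡ (sym (trans e′≡ (tabulate∘lookup (proj₁ e))))))

extend : ∀ {n k} → Hypergraph n k → Subset n → Bool
extend {k = k} H s with size s ℕₚ.≟ k
... | yes size≡k = H (s , size≡k)
... | no _       = false

extend-≡ : ∀ {n k} (H : Hypergraph n k) e → extend H (proj₁ e) ≡ H e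
extend-≡ {k = k} H (s , size≡k) with size s ℕₚ.≟ k
... | yes size≡k′ = cong (λ q → H (s , q)) (ℕₚ.≡-irrelevant size≡k′ size≡k)
... | no size≢k   = ⊥-elim (size≢k size≡k)

module BlowUp {n k : ℕ} (H : Hypergraph n k) (S : Subset n) (v : Fin n) (v∈S : lookup S v ≡ true) where

  core : Subset n
  core = S [ v ]≔ false

  trace : Subset n → Subset n
  trace e = zipWith _∧_ e core

  -- The first branch is `e` itself by `project-⊆core`. Writing it as `trace e` lets the result
  -- depend on `trace e` and one Boolean only, both invariant under permutations that fix `core`
  -- pointwise.
  project : Subset n → Subset n
  project e = if e ⊆ᵇ core then trace e else trace e [ v ]≔ true

  -- Every vertex outside core becomes a twin of v; an edge that meets more than one twin projects to a set with
  -- fewer than k elements, which extend discards.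
  blow-up : Hypergraph n k
  blow-up e = extend H (project (proj₁ e))

  lookup-trace : ∀ e i → lookup (trace e) i ≡ lookup e i ∧ lookup core i
  lookup-trace e i = lookup-zipWith _∧_ i e core

  project-⊆core : ∀ e → (e ⊆ᵇ core) ≡ true → project e ≡ e
  project-⊆core e e⊆core rewrite e⊆core = lookup-ext λ i → trans (lookup-trace e i) (absorb i (lookup e i) refl)
    where
    absorb : ∀ i b → lookup e i ≡ b → b ∧ lookup core i ≡ b
    absorb i true  ei = ⊆ᵇ-sound e core e⊆core i ei
    absorb i false ei = refl

  -- An edge inside `S` but not inside `core` contains `v`, the only point removed, so `project`
  -- puts back exactly what `trace` took away.
  project-⊆S : ∀ e → (e ⊆ᵇ S) ≡ true → project e ≡ e
  project-⊆S e e⊆S with e ⊆ᵇ core in e⊆core?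
  ... | true  = trans (cong (λ b → if b then trace e else trace e [ v ]≔ true) (sym e⊆core?)) (project-⊆core e e⊆core?)
  ... | false = lookup-ext same
    where
    core-≢v : ∀ {i} → i ≢ v → lookup core i ≡ lookup S i
    core-≢v i≢v = lookup∘update′ i≢v S false
    v∈e : lookup e v ≡ true
    v∈e with lookup e v in ev
    ... | true  = refl
    ... | false = trans (sym e⊆core?) (⊆ᵇ-complete e core λ i ei → trans (core-≢v (avoids ei)) (⊆ᵇ-sound e S e⊆S i ei))
      where
      avoids : ∀ {i} → lookup e i ≡ true → i ≢ v
      avoids ei refl with trans (sym ei) ev
      ... | ()
    absorb : ∀ i b → lookup e i ≡ b → b ∧ lookup S i ≡ b
    absorb i true  ei = ⊆ᵇ-sound e S e⊆S i ei
    absorb i false ei = refl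
    same : ∀ i → lookup (trace e [ v ]≔ true) i ≡ lookup e i
    same i with i Finₚ.≟ v
    ... | yes refl = trans (lookup∘update v (trace e) true) (sym v∈e)
    ... | no i≢v   = trans (lookup∘update′ i≢v (trace e) true)
      (trans (lookup-trace e i) (trans (cong (lookup e i ∧_) (core-≢v i≢v)) (absorb i (lookup e i) refl)))

  blow-up-agrees : ∀ z → (∀ e → (e ⊆ᵇ z) ≡ true → project e ≡ e) → ∀ e → induced blow-up z e ≡ induced H z e
  blow-up-agrees z fixed e with proj₁ e ⊆ᵇ z in e⊆z?
  ... | true  = cong (_∧ true) (trans (cong (extend H) (fixed (proj₁ e) e⊆z?)) (extend-≡ H e))
  ... | false = trans (Boolₚ.∧-zeroʳ (blow-up e)) (sym (Boolₚ.∧-zeroʳ (H e)))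

  module _ (σ : Permutation′ n) (fixes : ∀ i → lookup core i ≡ true → σ ⟨$⟩ˡ i ≡ i) where

    image-core : image σ core ≡ core
    image-core = image-≡ σ core core λ i → Bool-ext (preserve i) λ ci → trans (cong (lookup core) (fixes i ci)) ci
      where
      preserve : ∀ i → lookup core (σ ⟨$⟩ˡ i) ≡ true → lookup core i ≡ true
      preserve i cσi = trans (cong (lookup core) (sym σi≡i)) cσi
        where
        σi≡i : σ ⟨$⟩ˡ i ≡ i
        σi≡i = trans (sym (Perm.inverseʳ σ)) (trans (cong (σ ⟨$⟩ʳ_) (fixes (σ ⟨$⟩ˡ i) cσi)) (Perm.inverseʳ σ))

    trace-image : ∀ e → trace (image σ e) ≡ trace e
    trace-image e = lookup-ext λ i →
      trans (lookup-trace (image σ e) i) (trans (cong (_∧ lookup core i) (lookup-image σ e i))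
        (trans (same i (lookup core i) refl) (sym (lookup-trace e i))))
      where
      same : ∀ i b → lookup core i ≡ b → lookup e (σ ⟨$⟩ˡ i) ∧ b ≡ lookup e i ∧ lookup core i
      same i true  ci rewrite ci = cong (λ j → lookup e j ∧ true) (fixes i ci)
      same i false ci rewrite ci = trans (Boolₚ.∧-zeroʳ (lookup e (σ ⟨$⟩ˡ i))) (sym (Boolₚ.∧-zeroʳ (lookup e i)))

    project-image : ∀ e → project (image σ e) ≡ project e
    project-image e = cong₂ (λ b t → if b then t else t [ v ]≔ true)
      (trans (cong (image σ e ⊆ᵇ_) (sym image-core)) (image-⊆ᵇ σ e core)) (trace-image e)

    -- By `project-image` such a `σ` is an automorphism of `blow-up`, so relabelling merely moves
    -- `z`.
    blow-up-relabel : ∀ z → Relabel σ (induced blow-up z) (induced blow-up (image σ z))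
    blow-up-relabel z e e′ e′≡ rewrite e′≡ =
      cong₂ (λ s b → extend H s ∧ b) (sym (project-image (proj₁ e))) (sym (image-⊆ᵇ σ (proj₁ e) z))

  module _ {P : Hypergraph n k → Bool} (isP : IsHypergraphProperty P) where

    blow-up-value : ℕ → Bool
    blow-up-value w = P (induced blow-up (representative (above core) w))

    blow-up-symmetric : ∀ w z → InLevel (above core) w z → P (induced blow-up z) ≡ blow-up-value w
    blow-up-symmetric w z z∈
      with InLevel⇒Moves (above core) z∈ (representative∈ (above core) (InLevel⇒≤free z∈))
    ... | moves σ image≡ fixes = trans
      (isP _ _ σ (blow-up-relabel σ (λ i ci → fixes i true (above-fixed core i ci)) z))
      (cong (λ y → P (induced blow-up y)) image≡)

    blow-up-value-0 : blow-up-value 0 ≡ P (induced H core)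
    blow-up-value-0 = trans (sym (blow-up-symmetric 0 core (InLevel-above-bottom core)))
      (property-cong isP (blow-up-agrees core project-⊆core))

    blow-up-value-1 : blow-up-value 1 ≡ P (induced H S)
    blow-up-value-1 = trans (sym (blow-up-symmetric 1 S (InLevel-above-one S v v∈S)))
      (property-cong isP (blow-up-agrees S project-⊆S))

-- The bound on the number of vertices

minimal-subset : ∀ {n} {A : Subset n → Set} → (∀ z → Dec (A z)) → ∀ z → A z →
                 Σ (Subset n) λ S → A S × (∀ y → size y ℕ.< size S → ¬ A y)
minimal-subset {n} {A} A? z Az = descend (size z) z ℕₚ.≤-refl Az
  where
  descend : ∀ b z → size z ℕ.≤ b → A z → Σ (Subset n) λ S → A S × (∀ y → size y ℕ.< size S → ¬ A y)
  descend b z z≤b Az with anySubset? (λ y → (size y ℕₚ.<? size z) ×-dec A? y)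
  ... | no none = z , Az , λ y y<z Ay → none (y , y<z , Ay)
  descend zero    z z≤b Az | yes (y , y<z , Ay) = ⊥-elim (ℕₚ.n≮0 (ℕₚ.≤-trans y<z z≤b))
  descend (suc b) z z≤b Az | yes (y , y<z , Ay) = descend b y (ℕₚ.≤-pred (ℕₚ.≤-trans y<z z≤b)) Ay

⊆ᵇ-full : ∀ {n} (u : Subset n) → (u ⊆ᵇ full) ≡ true
⊆ᵇ-full []          = refl
⊆ᵇ-full (true ∷ u)  = ⊆ᵇ-full u
⊆ᵇ-full (false ∷ u) = ⊆ᵇ-full u

-- `r c` is the polynomial that is large where `P` has the value `c` and small elsewhere; this
-- indexing treats both polynomials at once.
module Bound {n k : ℕ} (1≤k : 1 ℕ.≤ k) {P : Hypergraph n k → Bool} (isP : IsHypergraphProperty P)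
  (r : Bool → Poly (KSet n k))
  (r-large : ∀ H → 1ℚ ≤ ∣ eval (r (P H)) H ∣) (r-small : ∀ H → ∣ eval (r (not (P H))) H ∣ ≤ third)
  (d : ℕ) (deg≤d : ∀ c → degree (r c) ℕ.≤ d)
  where

  -- Squaring doubles the degree `k d`. `Separates` is used with degree `suc m`, since `Deg-no-jump`
  -- splits off a linear factor.
  m : ℕ
  m = k ℕ.* d ℕ.+ k ℕ.* d

  separates : (H : Hypergraph n k) (μ : Mask n) (val : ℕ → Bool) →
              (∀ w z → InLevel μ w z → P (induced H z) ≡ val w) → Σ (Bool → ℚ → ℚ) (Separates m (free μ) val)
  separates H μ val levels = symmetrise μ (λ z → P (induced H z)) val levels (ℕₚ.n≤1+n m)
    (λ c z → eval (r c) (induced H z)) (λ c → eval-induced H (r c) (deg≤d c))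
    (λ z → r-large (induced H z)) (λ z → r-small (induced H z))

  module _ (b : Bool) (P-empty : P (λ _ → false) ≡ b) (H : Hypergraph n k) (P-H : P H ≡ not b) where

    vertex-bound : n ℕ.≤ suc (suc (suc m)) ℕ.* run m
    vertex-bound with minimal-subset (λ z → P (induced H z) Boolₚ.≟ not b) full
      (trans (property-cong isP λ e → trans (cong (H e ∧_) (⊆ᵇ-full (proj₁ e))) (Boolₚ.∧-identityʳ (H e))) P-H)
    ... | S , P-S , minimal with member? S
    -- Here `k ≥ 1` enters: no edge fits into an empty `S`, so `H[S]` is the empty hypergraph, whose
    -- value is `b`.
    ...   | inj₂ S-empty = ⊥-elim (Boolₚ.not-¬ {b} refl (trans (sym P-empty) (trans (property-cong isP no-edge) P-S)))
      where
      no-edge : ∀ e → false ≡ induced H S e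
      no-edge (e , size≡k) with e ⊆ᵇ S in e⊆S
      ... | false = sym (Boolₚ.∧-zeroʳ (H (e , size≡k)))
      ... | true  = ⊥-elim (ℕₚ.n≮0 (begin
          1       ≤⟨ 1≤k ⟩
          k       ≡⟨ size≡k ⟨
          size e  ≤⟨ ⊆ᵇ⇒size≤ e S e⊆S ⟩
          size S  ≡⟨ S-empty ⟩
          0       ∎))
        where open ℕₚ.≤-Reasoning
    ...   | inj₁ (v , v∈S) = begin
        n                                         ≡⟨ free-above core ⟨
        free (above core) ℕ.+ size core           ≤⟨ ℕₚ.+-mono-≤ outside-bound core-bound ⟩
        suc (suc m) ℕ.* run m ℕ.+ run m           ≡⟨ ℕₚ.+-comm (suc (suc m) ℕ.* run m) (run m) ⟩
        suc (suc (suc m)) ℕ.* run m               ∎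
      where
      open ℕₚ.≤-Reasoning
      open BlowUp H S v v∈S
      small-value : ∀ z → size z ℕ.< size S → P (induced H z) ≡ b
      small-value z z<S = trans (≢⇒≡not (minimal z z<S)) (Boolₚ.not-involutive b)
      size-S : size S ≡ suc (size core)
      size-S = size-remove S v v∈S
      threshold : ℕ → Bool
      threshold w with w ℕₚ.<? size S
      ... | yes _ = b
      ... | no _  = not b
      threshold-level : ∀ w z → InLevel (below S) w z → P (induced H z) ≡ threshold w
      threshold-level w z z∈ with w ℕₚ.<? size S
      ... | yes w<S = small-value z (subst (ℕ._< size S) (sym (InLevel-below-size S z∈)) w<S)
      ... | no w≮S
        with refl ← ℕₚ.≤-antisym (subst (w ℕ.≤_) (free-below S) (InLevel⇒≤free z∈)) (ℕₚ.≮⇒≥ w≮S) =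
        trans (cong (λ y → P (induced H y)) (InLevel-below-top S z∈)) P-S
      threshold-below : ∀ w → w ℕ.< free (below S) → threshold w ≡ b
      threshold-below w w< with w ℕₚ.<? size S
      ... | yes _  = refl
      ... | no w≮S = ⊥-elim (w≮S (subst (w ℕ.<_) (free-below S) w<))
      threshold-top : threshold (free (below S)) ≡ not b
      threshold-top with free (below S) ℕₚ.<? size S
      ... | yes lt = ⊥-elim (ℕₚ.<-irrefl (free-below S) lt)
      ... | no _   = refl
      core-bound : size core ℕ.≤ run m
      core-bound = ℕₚ.≤-trans (ℕₚ.n≤1+n (size core))
        (subst (ℕ._≤ run m) (trans (free-below S) size-S)
          (ℕₚ.<⇒≤ (Separates.threshold-bound (proj₂ (separates H (below S) threshold threshold-level))
            b threshold-below threshold-top)))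
      outside-bound : free (above core) ℕ.≤ suc (suc m) ℕ.* run m
      outside-bound = Separates.symmetric-bound
        (proj₂ (separates blow-up (above core) (blow-up-value isP) (blow-up-symmetric isP)))
        (trans (blow-up-value-1 isP) (trans P-S (cong not (sym
          (trans (blow-up-value-0 isP) (small-value core (ℕₚ.≤-reflexive (sym size-S))))))))

  nonconstant-bound : NonConstant P → n ℕ.≤ suc (suc (suc m)) ℕ.* run m
  nonconstant-bound (H₁ , H₀ , P-H₁ , P-H₀) with P (λ _ → false) in P-empty
  ... | true  = vertex-bound true P-empty H₀ P-H₀
  ... | false = vertex-bound false P-empty H₁ P-H₁

-- From the bound on the number of vertices to the stated inequality

ι-/ : ∀ n → ι n ≡ ℤ.+ n / 1
ι-/ zero    = refl
ι-/ (suc n) = begin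
  1ℚ + ι n                                         ≡⟨ cong (1ℚ +_) (trans (ι-/ n) normal) ⟩
  1ℚ + mkℚ (ℤ.+ n) 0 coprime                       ≡⟨ cong (λ i → (ℤ.+ 1 ℤ.+ i) / 1) (ℤₚ.*-identityʳ (ℤ.+ n)) ⟩
  ℤ.+ suc n / 1                                    ∎
  where
  open ≡-Reasoning
  coprime = coprime-sym (1-coprimeTo n)
  normal : ℤ.+ n / 1 ≡ mkℚ (ℤ.+ n) 0 coprime
  normal = normalize-coprime coprime

run-bound : ∀ m → suc (suc (suc m)) ℕ.* run m ℕ.≤ (3 ℕ.+ m) ^ 4
run-bound m = begin
  (3 ℕ.+ m) ℕ.* run m
    ≤⟨ ℕₚ.*-monoʳ-≤ (3 ℕ.+ m) (ℕₚ.*-monoʳ-≤ (3 ℕ.+ m) (ℕₚ.*-mono-≤ (ℕₚ.+-monoˡ-≤ m {1} {3} (s≤s z≤n)) (ℕₚ.n≤1+n (2 ℕ.+ m)))) ⟩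
  (3 ℕ.+ m) ℕ.* ((3 ℕ.+ m) ℕ.* ((3 ℕ.+ m) ℕ.* (3 ℕ.+ m)))
    ≡⟨ cong (λ y → (3 ℕ.+ m) ℕ.* ((3 ℕ.+ m) ℕ.* ((3 ℕ.+ m) ℕ.* y))) (ℕₚ.*-identityʳ (3 ℕ.+ m)) ⟨
  (3 ℕ.+ m) ^ 4 ∎
  where open ℕₚ.≤-Reasoning

*-^ : ∀ j a b → (a ℕ.* b) ^ j ≡ a ^ j ℕ.* b ^ j
*-^ zero    a b = refl
*-^ (suc j) a b = trans (cong (a ℕ.* b ℕ.*_) (*-^ j a b)) (interchange ℕₚ.*-commutativeSemigroup a b (a ^ j) (b ^ j))

final-bound : ∀ k d n → 82 ℕ.≤ n → n ℕ.≤ (3 ℕ.+ (k ℕ.* d ℕ.+ k ℕ.* d)) ^ 4 →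
              n ℕ.≤ (3 ℕ.+ (k ℕ.+ k)) ^ 4 ℕ.* d ^ 6
-- For `d = 0` the hypothesis reads `n ≤ 3 ^ 4 = 81`; this fixes the threshold 82.
final-bound k zero n 82≤n n≤ rewrite ℕₚ.*-zeroʳ k = ⊥-elim (ℕₚ.<-irrefl refl (ℕₚ.≤-trans 82≤n n≤))
final-bound k d@(suc _) n _ n≤ = begin
  n                                           ≤⟨ n≤ ⟩
  (3 ℕ.+ (k ℕ.* d ℕ.+ k ℕ.* d)) ^ 4           ≤⟨ ℕₚ.^-monoˡ-≤ 4 (ℕₚ.+-monoˡ-≤ (k ℕ.* d ℕ.+ k ℕ.* d) (ℕₚ.m≤m*n 3 d)) ⟩
  (3 ℕ.* d ℕ.+ (k ℕ.* d ℕ.+ k ℕ.* d)) ^ 4     ≡⟨ cong (_^ 4) (factor k d) ⟩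
  ((3 ℕ.+ (k ℕ.+ k)) ℕ.* d) ^ 4               ≡⟨ *-^ 4 (3 ℕ.+ (k ℕ.+ k)) d ⟩
  -- As `d ≥ 1`, the fourth power may be weakened to the sixth power that the theorem asks for.
  (3 ℕ.+ (k ℕ.+ k)) ^ 4 ℕ.* d ^ 4             ≤⟨ ℕₚ.*-monoʳ-≤ ((3 ℕ.+ (k ℕ.+ k)) ^ 4) (ℕₚ.^-monoʳ-≤ d {4} {6} (ℕₚ.m≤m+n 4 2)) ⟩
  (3 ℕ.+ (k ℕ.+ k)) ^ 4 ℕ.* d ^ 6             ∎
  where
  open ℕₚ.≤-Reasoning
  factor : ∀ k d → 3 ℕ.* d ℕ.+ (k ℕ.* d ℕ.+ k ℕ.* d) ≡ (3 ℕ.+ (k ℕ.+ k)) ℕ.* d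
  factor = ℕ-Solver.solve-∀

open import Data.Integer using (+_)

theorem4 : (k : ℕ) → k ≥ 1 →
    Σ ℚ (λ c → (0ℚ < c) × Σ ℕ (λ n₀ →
    (n : ℕ) → n ≥ n₀ → (P : Hypergraph n k → Bool) →
    IsHypergraphProperty P → NonConstant P →
    (p q : Poly (KSet n k)) → Approximates p P → Approximates q (complement P) →
    c * (+ n / 1) ≤ (+ ((degree p ⊔ degree q) ^ 6) / 1)))
-- `c` is the inverse of the factor in front of `d ^ 6` in `final-bound`, which depends on `k`
-- alone.
theorem4 k 1≤k with reciprocal (ι ((3 ℕ.+ (k ℕ.+ k)) ^ 4))
                     (<-≤-trans (ι-pos 0) (ι-mono (ℕₚ.m^n>0 (3 ℕ.+ (k ℕ.+ k)) 4)))
... | c , 0<c , c-inverse = c , 0<c , 82 , λ n 82≤n P isP nonconstant p q p-approx q-approx →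
  let
    d = degree p ⊔ degree q
    C = (3 ℕ.+ (k ℕ.+ k)) ^ 4
    r : Bool → Poly (KSet n k)
    r = λ b → if b then p else q
    large : ∀ H → 1ℚ ≤ ∣ eval (r (P H)) H ∣
    large H = approx-large p q p-approx q-approx H (P H) refl
    small : ∀ H → ∣ eval (r (not (P H))) H ∣ ≤ third
    small H = approx-small p q p-approx q-approx H (P H) refl
    deg≤ : ∀ b → degree (r b) ℕ.≤ d
    deg≤ = λ { true → ℕₚ.m≤m⊔n (degree p) (degree q) ; false → ℕₚ.m≤n⊔m (degree p) (degree q) }
    n≤ : n ℕ.≤ C ℕ.* d ^ 6
    n≤ = final-bound k d n 82≤n
      (ℕₚ.≤-trans (Bound.nonconstant-bound 1≤k isP r large small d deg≤ nonconstant) (run-bound (k ℕ.* d ℕ.+ k ℕ.* d)))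
  in subst₂ (λ x y → c * x ≤ y) (ι-/ n) (ι-/ (d ^ 6))
       (≤-trans (*-monoˡ-≤ (<⇒≤ 0<c) (ι-mono n≤)) (≤-reflexive (begin
         c * ι (C ℕ.* d ^ 6)      ≡⟨ cong (c *_) (ι-* C (d ^ 6)) ⟩
         c * (ι C * ι (d ^ 6))    ≡⟨ *-assoc c (ι C) (ι (d ^ 6)) ⟨
         (c * ι C) * ι (d ^ 6)    ≡⟨ cong (_* ι (d ^ 6)) c-inverse ⟩
         1ℚ * ι (d ^ 6)           ≡⟨ *-identityˡ (ι (d ^ 6)) ⟩
         ι (d ^ 6)                ∎)))
  where
  open ≡-Reasoning
  approx-large : ∀ {n} {P : Hypergraph n k → Bool} p q → Approximates p P → Approximates q (complement P) →
                 ∀ H b → P H ≡ b → 1ℚ ≤ ∣ eval (if b then p else q) H ∣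
  approx-large p q p-approx q-approx H true  eq = proj₂ (p-approx H) eq
  approx-large p q p-approx q-approx H false eq = proj₂ (q-approx H) (cong not eq)
  approx-small : ∀ {n} {P : Hypergraph n k → Bool} p q → Approximates p P → Approximates q (complement P) →
                 ∀ H b → P H ≡ b → ∣ eval (if not b then p else q) H ∣ ≤ third
  approx-small p q p-approx q-approx H true  eq = proj₁ (q-approx H) (cong not eq)
  approx-small p q p-approx q-approx H false eq = proj₁ (p-approx H) eq
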